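{- Consider an arbitrary $n$-node graph $G$ where each node has a unique $b$-bit identifier with $b = O(\log n)$, together with a subset $S \subseteq V$ of living vertices. There is a deterministic distributed algorithm that in $O(\log^4 n)$ rounds of the $\mathsf{CONGEST}$ model finds a subset $S' \subseteq S$ with $|S'| \ge |S|/2$ such that $S'$ is partitioned into disjoint clusters, no two of which are joined by an edge of $G$, each cluster having weak-diameter $O(\log^2 n)$ in $G$. Moreover, for each cluster $\mathcal{C}$, the algorithm provides a Steiner tree $T_{\mathcal{C}}$ with radius $O(\log^2 n)$ in $G$ whose set of terminal nodes is equal to $\mathcal{C}$, and each vertex of $G$ is in $O(\log n)$ of these Steiner trees.
   Context: $\mathsf{CONGEST}$ model: synchronous rounds on the network $G$; per round each node sends one $O(\log n)$-bit message to each neighbor; nodes initially know only local information. The weak-diameter of a vertex set $\mathcal{C}$ is the maximum distance in $G$ between two of its vertices. A Steiner tree for a cluster $\mathcal{C}$ is a subtree of $G$ containing all vertices of $\mathcal{C}$ (its terminal nodes) and possibly other vertices (non-terminal nodes). -}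

module Defs where

open import Data.Bool.Base using (Bool; T)
open import Data.Fin.Base using (Fin)
open import Data.Fin.Subset using (Subset; _⊆_; ∣_∣) renaming (_∈_ to _∈ₛ_)
open import Data.List.Base using (List; _∷_; _++_; [_]; length)
open import Data.List.Membership.Propositional using (_∈_)
open import Data.List.Relation.Unary.All using (All)
open import Data.List.Relation.Unary.Linked using (Linked)
open import Data.List.Relation.Unary.Unique.Propositional using (Unique)
open import Data.Maybe.Base using (Maybe; just; is-just)
open import Data.Nat.Base using (ℕ; zero; suc; _*_; _≤_)
open import Data.Nat.Logarithm using (⌊log₂_⌋)
open import Data.Product.Base using (Σ; ∃-syntax; _×_; _,_; proj₁)
open import Data.Vec.Base using (Vec; lookup; tabulate)
open import Data.Vec.Bounded.Base using (Vec≤)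
open import Function.Bundles using (_↔_; module Inverse)
open import Level using (0ℓ)
open import Relation.Binary.Core using (Rel)
open import Relation.Binary.PropositionalEquality.Core using (_≡_)
open import Relation.Nullary.Negation.Core using (¬_)
open import Relation.Unary using (Pred; Satisfiable)

-- The binary length of n.  For n ≥ 2 it lies between log₂ n and 2 log₂ n, so
-- O(log n) and O(lg n) agree; unlike log₂ it is also positive at n = 1, where
-- a bound by a multiple of log₂ n would force quantities such as the number
-- of trees at the single vertex to vanish.
lg : ℕ → ℕ
lg n = suc ⌊log₂ n ⌋

record Graph (n : ℕ) : Set where
  field
    adjacent    : Fin n → Fin n → Bool
    symmetric   : ∀ {u v} → T (adjacent u v) → T (adjacent v u)
    irreflexive : ∀ {v} → ¬ T (adjacent v v)

  Adj : Rel (Fin n) 0ℓ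
  Adj u v = T (adjacent u v)

-- A node knows its incident edges only as anonymous ports; which neighbour
-- lies behind which port is an arbitrary choice.
record PortNumbering {n : ℕ} (G : Graph n) : Set where
  open Graph G
  field
    degree : Fin n → ℕ
    port   : ∀ v → Fin (degree v) ↔ Σ (Fin n) (Adj v)

  neighbour : ∀ v → Fin (degree v) → Fin n
  neighbour v p = proj₁ (Inverse.to (port v) p)

-- A deterministic synchronous message-passing algorithm.  The index of State
-- is the degree of the node.  Local computation and memory are unbounded;
-- a message is a bit string of length at most `bandwidth`.
record Algorithm (bandwidth : ℕ) (Input : Set) (Output : ℕ → Set) : Set₁ where
  Message : Set
  Message = Vec≤ Bool bandwidth

  field
    State   : ℕ → Set
    init    : ∀ d → Input → State d
    send    : ∀ {d} → State d → Fin d → Message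
    receive : ∀ {d} → State d → (Fin d → Message) → State d
    rounds  : ℕ
    output  : ∀ {d} → State d → Output d

module Execution {n bandwidth : ℕ} {Input : Set} {Output : ℕ → Set}
  (𝒜 : Algorithm bandwidth Input Output)
  {G : Graph n} (P : PortNumbering G) (input : Fin n → Input) where

  open Algorithm 𝒜
  open Graph G
  open PortNumbering P

  stateAfter : ℕ → ∀ v → State (degree v)
  stateAfter zero    v = init (degree v) (input v)
  stateAfter (suc t) v = receive (stateAfter t v) inbox
    where
    inbox : Fin (degree v) → Message
    inbox p with Inverse.to (port v) p
    ... | u , v~u = send (stateAfter t u) (Inverse.from (port u) (v , symmetric v~u))

  result : ∀ v → Output (degree v)
  result v = output (stateAfter rounds v)

record LocalInput (b : ℕ) : Set where
  constructor localInput
  field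
    identifier : Vec Bool b
    living     : Bool

-- `cluster` is the label of the cluster of the node, or `nothing` if the node
-- is not in S′.  An entry (ℓ , E) of `trees` says that the node belongs to the
-- Steiner tree of cluster ℓ, and that its ports in E carry edges of this tree.
record LocalOutput (d : ℕ) : Set where
  field
    cluster : Maybe ℕ
    trees   : List (ℕ × Subset d)

-- One algorithm for all networks: what a node does depends, besides its local
-- information, only on the globally known n and b.
CONGESTAlgorithm : (β : ℕ) → Set₁
CONGESTAlgorithm β = ∀ n b → Algorithm (β * lg n) (LocalInput b) LocalOutput

localInputs : ∀ {n b} → (Fin n → Vec Bool b) → Subset n → Fin n → LocalInput b
localInputs identifier S v = localInput (identifier v) (lookup S v)

data Walk {A : Set} (E : Rel A 0ℓ) : ℕ → Rel A 0ℓ where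
  here : ∀ {u} → Walk E 0 u u
  step : ∀ {k u v w} → E u v → Walk E k v w → Walk E (suc k) u w

-- The distance is the least length of a walk, and infinite if there is none.
Distance≤ : {A : Set} → Rel A 0ℓ → ℕ → Rel A 0ℓ
Distance≤ E d u v = ∃[ k ] k ≤ d × Walk E k u v

-- Distances are taken in all of G, not in the subgraph induced by C.
WeakDiameter≤ : ∀ {n} → Graph n → Pred (Fin n) 0ℓ → ℕ → Set
WeakDiameter≤ G C d = ∀ {u v} → C u → C v → Distance≤ (Graph.Adj G) d u v

-- The cycle v, vs₁, …, vsₖ, v.
IsCycle : {A : Set} → Rel A 0ℓ → A → List A → Set
IsCycle E v vs = 2 ≤ length vs × Unique (v ∷ vs) × Linked E (v ∷ vs ++ [ v ])

record VertexEdgeSet (n : ℕ) : Set₁ where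
  field
    V : Pred (Fin n) 0ℓ
    E : Rel (Fin n) 0ℓ

record IsSubtree {n : ℕ} (G : Graph n) (H : VertexEdgeSet n) : Set where
  open VertexEdgeSet H
  field
    edges⊆G   : ∀ {u v} → E u v → Graph.Adj G u v
    symmetric : ∀ {u v} → E u v → E v u
    endpoint  : ∀ {u v} → E u v → V u
    nonempty  : Satisfiable V
    connected : ∀ {u v} → V u → V v → ∃[ k ] Walk E k u v
    acyclic   : ∀ {v vs} → ¬ IsCycle E v vs

record IsSteinerTree {n : ℕ} (G : Graph n) (C : Pred (Fin n) 0ℓ)
                     (H : VertexEdgeSet n) : Set where
  open VertexEdgeSet H
  field
    isSubtree : IsSubtree G H
    terminals : ∀ {v} → C v → V v

-- Distances are taken inside H; the radius is the minimum, over the possible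
-- centres, of the largest distance from the centre.
Radius≤ : ∀ {n} → VertexEdgeSet n → ℕ → Set
Radius≤ H r = ∃[ c ] V c × (∀ {v} → V v → Distance≤ E r c v)
  where open VertexEdgeSet H

AtMost : {A : Set} → ℕ → Pred A 0ℓ → Set
AtMost {A} k P = (xs : List A) → Unique xs → All P xs → length xs ≤ k

module Clustering {n : ℕ} {G : Graph n} (P : PortNumbering G)
  (out : ∀ v → LocalOutput (PortNumbering.degree P v)) where

  open PortNumbering P
  open LocalOutput

  S′ : Subset n
  S′ = tabulate λ v → is-just (cluster (out v))

  Cluster : ℕ → Pred (Fin n) 0ℓ
  Cluster ℓ v = cluster (out v) ≡ just ℓ

  -- The labels that name a cluster.
  IsLabel : Pred ℕ 0ℓ
  IsLabel ℓ = Satisfiable (Cluster ℓ)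

  tree : ℕ → VertexEdgeSet n
  tree ℓ = record
    { V = λ v → ∃[ E ] (ℓ , E) ∈ trees (out v)
    ; E = λ u v → ∃[ E ] (ℓ , E) ∈ trees (out u) × (∃[ p ] p ∈ₛ E × neighbour u p ≡ v)
    }

-- The outputs describe S′, its partition into clusters (the vertices with equal
-- labels), and their Steiner trees, with the given bounds on the weak-diameter,
-- the radius and the number of trees at a vertex.
record IsClustering {n : ℕ} {G : Graph n} (P : PortNumbering G) (S : Subset n)
  (out : ∀ v → LocalOutput (PortNumbering.degree P v))
  (diam rad load : ℕ) : Set where

  open Graph G
  open Clustering P out

  field
    S′⊆S         : S′ ⊆ S
    half         : ∣ S ∣ ≤ 2 * ∣ S′ ∣
    separated    : ∀ {u v ℓ ℓ′} → Cluster ℓ u → Cluster ℓ′ v → Adj u v → ℓ ≡ ℓ′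
    weakDiameter : ∀ {ℓ} → IsLabel ℓ → WeakDiameter≤ G (Cluster ℓ) diam
    steinerTree  : ∀ {ℓ} → IsLabel ℓ → IsSteinerTree G (Cluster ℓ) (tree ℓ)
    radius       : ∀ {ℓ} → IsLabel ℓ → Radius≤ (tree ℓ) rad
    congestion   : ∀ v → AtMost load (λ ℓ → IsLabel ℓ × VertexEdgeSet.V (tree ℓ) v)

-- The algorithm is that of Ghaffari, Grunau and Rozhoň.  Clusters carry the
-- identifier of their founder and a level; a cluster of level l has rank 2l, or
-- 2l + 1 if bit l of its identifier is 0.  In every step each node with a
-- neighbour in a cluster of lower rank proposes to such a cluster of least rank.
-- A cluster with t tokens and x proposals admits the proposers, gaining x tokens,
-- if x ≥ t / K; otherwise it kills them, pays 2M tokens for each, and stalls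
-- until the end of the phase of K steps, when its level rises.
--
-- While a cluster stalls no adjacent cluster has larger rank, so
-- adjacent clusters always agree on the identifier bits below both their levels;
-- at level b they coincide.  A move lowers the rank of the cluster of a node and
-- a phase raises it by at most 3, so a node moves fewer than M times, at most
-- |S| M tokens are issued and at most |S| / 2 nodes die.  A phase doubles the
-- tokens of a cluster or makes it stall, which at most halves them, so O(b)
-- phases bring every cluster to level b.
--
-- A Steiner tree grows by one edge whenever a node joins it for the first time.
-- Proposals are counted, and verdicts spread, along these trees, edges being
-- used in the order of their creation: this takes O(b²) rounds per step.
module Submission where

open import Defs
open import Data.Bool.Base using (Bool; true; false; if_then_else_; not; _∧_)
open import Data.Bool.Properties using (T?; T-irrelevant) renaming (_≟_ to _≟ᵇ_)
open import Data.Fin.Base using (Fin; zero; suc; fromℕ<)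
open import Data.Fin.Properties using (injective⇒≤; fromℕ<-injective) renaming (_≟_ to _≟ᶠ_)
open import Data.Fin.Subset using (Subset; ∣_∣) renaming (_∈_ to _∈ₛ_)
open import Data.List.Base as List using (List; []; _∷_; _++_; [_]; length)
open import Data.List.Membership.Propositional using (_∈_; _∉_)
open import Data.List.Membership.Propositional.Properties using (∈-map⁺; ∈-map⁻; ∈-∃++; ∈-++⁻; ∈-++⁺ˡ; ∈-++⁺ʳ)
open import Data.List.Properties using (length-++; length-map)
open import Data.List.Relation.Unary.All as All using (All; []; _∷_)
open import Data.List.Relation.Unary.AllPairs using ([]; _∷_)
open import Data.List.Relation.Unary.Any using (here; there)
open import Data.List.Relation.Unary.Linked using (Linked; _∷_)
open import Data.List.Relation.Unary.Unique.Propositional using (Unique)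
open import Data.Maybe.Base as Maybe using (Maybe; just; nothing; maybe; _>>=_; is-just)
open import Data.Maybe.Properties using (just-injective) renaming (≡-dec to ≡-decᵐ)
open import Data.Nat.Base using (ℕ; zero; suc; _+_; _*_; _^_; _∸_; _⊓_; _≤_; _<_; _/_; _%_; z≤n; s≤s; s≤s⁻¹; >-nonZero)
open import Data.Nat.DivMod using (m≡m%n+[m/n]*n; m%n<n; m<n*o⇒m/o<n)
open import Data.Nat.Properties
open import Algebra.Properties.Semiring.Sum +-*-semiring
  using (sum; sum-cong-≗; ∑-comm; ∑-distrib-+; *-distribˡ-sum; *-distribʳ-sum; sum-replicate-zero)
open import Data.Nat.Tactic.RingSolver using (solve-∀)
open import Data.Product.Base using (Σ; Σ-syntax; ∃-syntax; _×_; _,_; proj₁; proj₂)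
open import Data.Sum.Base using (_⊎_; inj₁; inj₂)
open import Data.Unit.Base using (⊤; tt)
open import Data.Vec.Base as Vec using (Vec; []; _∷_; lookup; tabulate)
open import Data.Vec.Bounded.Base using (Vec≤)
open import Data.Vec.Properties using (take++drop≡id; ++-injective; lookup∘tabulate; lookup⇒[]=; []=⇒lookup) renaming (≡-dec to ≡-decᵛ)
open import Function.Bundles using (module Inverse)
open import Function.Definitions using (Injective)
open import Level using (0ℓ)
open import Relation.Binary.Core using (Rel)
open import Relation.Binary.Definitions using (DecidableEquality)
open import Relation.Binary.PropositionalEquality using (_≡_; _≢_; refl; sym; trans; cong; cong₂; subst; subst₂; module ≡-Reasoning)
open import Relation.Nullary using (¬_; Dec; does; yes; no; contradiction)
open import Relation.Nullary.Decidable using (dec-true; dec-false; _⊎-dec_)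
import Data.List.Membership.DecPropositional as DecMembership

-- The constants close a loop. With `m` phases a node may move about `3 * m` times, and `M` must
-- exceed this. All clusters together then hold at most `∣ S ∣ * M` tokens, while a level costs a
-- cluster a factor 4: the halving, and the doubling forgone in that phase. A cluster unfinished
-- after `m` phases would still own `2 ^ m / (2 * 4 ^ b)` tokens, which is absurd once `2 ^ m`
-- exceeds `2 * (2 ^ b * M * 4 ^ b)`. Since `M` enters only through its logarithm, `m` and `M`
-- linear in `b` suffice. The halving comes from `4 * M ≤ K`: a refusal means `x * K < t`, so the
-- price `x * (2 * M)` is below `t / 2`. The other obstacle is that a cluster need not be connected:
-- members leave or die, the founder perhaps among them. Hence no node ever leaves a tree, and a
-- founder goes on deciding for its identifier wherever it has gone. The carving is analysed on
-- `Config`, without messages, and the nodes are shown to compute it.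

if-yes : ∀ {A B : Set} (a? : Dec A) {x y : B} → A → (if does a? then x else y) ≡ x
if-yes (yes _) _ = refl
if-yes (no ¬a) a = contradiction a ¬a

if-no : ∀ {A B : Set} (a? : Dec A) {x y : B} → ¬ A → (if does a? then x else y) ≡ y
if-no (yes a) ¬a = contradiction a ¬a
if-no (no _)  _  = refl

-- Binary numerals

bit : Bool → ℕ
bit x = if x then 1 else 0

bit≤1 : ∀ x → bit x ≤ 1
bit≤1 true  = ≤-refl
bit≤1 false = z≤n

isOne : ℕ → Bool
isOne 1 = true
isOne _ = false

bit-isOne : ∀ {k} → k < 2 → bit (isOne k) ≡ k
bit-isOne {0} _ = refl
bit-isOne {1} _ = refl
bit-isOne {suc (suc _)} (s≤s (s≤s ()))

toBits : ∀ m → ℕ → Vec Bool m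
toBits zero    x = []
toBits (suc m) x = isOne (x % 2) ∷ toBits m (x / 2)

fromBits : ∀ {m} → Vec Bool m → ℕ
fromBits []       = 0
fromBits (x ∷ xs) = bit x + fromBits xs * 2

fromBits-toBits : ∀ m {x} → x < 2 ^ m → fromBits (toBits m x) ≡ x
fromBits-toBits zero    {zero} _ = refl
fromBits-toBits zero    {suc x} (s≤s ())
fromBits-toBits (suc m) {x} x<2^ = trans
  (cong₂ (λ a q → a + q * 2) (bit-isOne (m%n<n x 2))
    (fromBits-toBits m (m<n*o⇒m/o<n (subst (x <_) (*-comm 2 (2 ^ m)) x<2^))))
  (sym (m≡m%n+[m/n]*n x 2))

fromBits< : ∀ {m} (xs : Vec Bool m) → fromBits xs < 2 ^ m
fromBits< []       = s≤s z≤n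
fromBits< {suc m} (x ∷ xs) = begin-strict
  bit x + fromBits xs * 2  ≤⟨ +-monoˡ-≤ _ (bit≤1 x) ⟩
  1 + fromBits xs * 2      <⟨ n<1+n _ ⟩
  suc (fromBits xs) * 2    ≤⟨ *-monoˡ-≤ 2 (fromBits< xs) ⟩
  2 ^ m * 2                ≡⟨ *-comm (2 ^ m) 2 ⟩
  2 ^ suc m                ∎
  where open ≤-Reasoning

fromBits-injective : ∀ {m} → Injective _≡_ _≡_ (fromBits {m})
fromBits-injective {x = []} {[]} _ = refl
fromBits-injective {x = true ∷ xs} {true ∷ ys} eq =
  cong (true ∷_) (fromBits-injective (*-cancelʳ-≡ _ _ 2 (suc-injective eq)))
fromBits-injective {x = false ∷ xs} {false ∷ ys} eq =
  cong (false ∷_) (fromBits-injective (*-cancelʳ-≡ _ _ 2 eq))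
fromBits-injective {x = true ∷ xs} {false ∷ ys} eq = contradiction
  (trans (*-comm 2 (fromBits ys)) (trans (sym eq) (cong suc (*-comm (fromBits xs) 2))))
  (even≢odd (fromBits ys) (fromBits xs))
fromBits-injective {x = false ∷ xs} {true ∷ ys} eq = contradiction
  (trans (*-comm 2 (fromBits xs)) (trans eq (cong suc (*-comm (fromBits ys) 2))))
  (even≢odd (fromBits xs) (fromBits ys))

b<2^b : ∀ b → b < 2 ^ b
b<2^b zero    = s≤s z≤n
b<2^b (suc b) = begin-strict
  suc b             ≤⟨ b<2^b b ⟩
  2 ^ b             <⟨ m<m+n (2 ^ b) (m^n>0 2 b) ⟩
  2 ^ b + 2 ^ b     ≡⟨ cong (2 ^ b +_) (sym (+-identityʳ _)) ⟩
  2 ^ suc b         ∎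
  where open ≤-Reasoning

-- This lets `b` replace `n` in all bounds: the number of tokens, and the size of the counts that
-- messages carry.
injective⇒≤2^ : ∀ {n b} {f : Fin n → Vec Bool b} → Injective _≡_ _≡_ f → n ≤ 2 ^ b
injective⇒≤2^ {f = f} f-inj = injective⇒≤ {f = λ v → fromℕ< (fromBits< (f v))}
  λ {u} {v} eq → f-inj (fromBits-injective (fromℕ<-injective _ _ (fromBits< (f u)) (fromBits< (f v)) eq))

-- Finite sums

sum-mono : ∀ {n} {f g : Fin n → ℕ} → (∀ v → f v ≤ g v) → sum f ≤ sum g
sum-mono {zero}  f≤g = z≤n
sum-mono {suc n} f≤g = +-mono-≤ (f≤g zero) (sum-mono (λ v → f≤g (suc v)))

term≤sum : ∀ {n} (f : Fin n → ℕ) v → f v ≤ sum f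
term≤sum f zero    = m≤m+n _ _
term≤sum f (suc v) = ≤-trans (term≤sum (λ u → f (suc u)) v) (m≤n+m _ (f zero))

sum≤* : ∀ {n} {f : Fin n → ℕ} {k} → (∀ v → f v ≤ k) → sum f ≤ n * k
sum≤* {zero}  f≤k = z≤n
sum≤* {suc n} f≤k = +-mono-≤ (f≤k zero) (sum≤* (λ v → f≤k (suc v)))

sum-zero : ∀ {n} {f : Fin n → ℕ} → (∀ v → f v ≡ 0) → sum f ≡ 0
sum-zero {n} f≡0 = trans (sum-cong-≗ f≡0) (sum-replicate-zero n)

sum-single : ∀ {n} (f : Fin n → ℕ) v → (∀ u → u ≢ v → f u ≡ 0) → sum f ≡ f v
sum-single f zero f≡0 = trans (cong (f zero +_) (sum-zero (λ u → f≡0 (suc u) λ ()))) (+-identityʳ _)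
sum-single f (suc v) f≡0 = trans
  (cong (_+ sum (λ u → f (suc u))) (f≡0 zero λ ()))
  (sum-single (λ u → f (suc u)) v (λ u u≢v → f≡0 (suc u) (λ { refl → u≢v refl })))

sum-positive : ∀ {n} (f : Fin n → ℕ) → sum f ≢ 0 → ∃[ v ] f v ≢ 0
sum-positive {zero} f ≢0 = contradiction refl ≢0
sum-positive {suc n} f ≢0 with f zero in eq
... | suc k = zero , λ eq′ → 1+n≢0 (trans (sym eq) eq′)
... | zero with sum-positive (λ v → f (suc v)) ≢0
... | v , fv≢0 = suc v , fv≢0

∣S∣≡sum : ∀ {n} (S : Subset n) → ∣ S ∣ ≡ sum (λ v → bit (lookup S v))
∣S∣≡sum []          = refl
∣S∣≡sum (true ∷ S)  = cong suc (∣S∣≡sum S)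
∣S∣≡sum (false ∷ S) = ∣S∣≡sum S

-- Ports and half-edges

module Network {n : ℕ} {G : Graph n} (P : PortNumbering G) where
  open Graph G
  open PortNumbering P

  back : ∀ v (p : Fin (degree v)) → Fin (degree (neighbour v p))
  back v p = Inverse.from (port (neighbour v p)) (v , symmetric (proj₂ (Inverse.to (port v) p)))

  neighbour-from : ∀ v (z : Σ (Fin n) (Adj v)) → neighbour v (Inverse.from (port v) z) ≡ proj₁ z
  neighbour-from v z = cong proj₁ (Inverse.strictlyInverseˡ (port v) z)

  neighbour-back : ∀ v p → neighbour (neighbour v p) (back v p) ≡ v
  neighbour-back v p = neighbour-from (neighbour v p) _

  neighbour-adjacent : ∀ v p → Adj v (neighbour v p)
  neighbour-adjacent v p = proj₂ (Inverse.to (port v) p)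

  -- Ports are in bijection with incident edges, and an edge is determined by its far end because
  -- `T` is proof-irrelevant.
  neighbour-injective : ∀ v {p q} → neighbour v p ≡ neighbour v q → p ≡ q
  neighbour-injective v {p} {q} eq = trans (sym (Inverse.strictlyInverseʳ (port v) p))
    (trans (cong (Inverse.from (port v)) (edge-≡ eq)) (Inverse.strictlyInverseʳ (port v) q))
    where
    edge-≡ : {y z : Σ (Fin n) (Adj v)} → proj₁ y ≡ proj₁ z → y ≡ z
    edge-≡ {u , e} {.u , e′} refl = cong (u ,_) (T-irrelevant e e′)

  portTo : ∀ {u v} → Adj u v → ∃[ p ] neighbour u p ≡ v
  portTo {u} {v} e = Inverse.from (port u) (v , e) , neighbour-from u (v , e)

  private
    -- Extension by zero from the incident edges to all vertices. It turns sums over ports, whose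
    -- range varies with the vertex, into sums over a square, to which `∑-comm` applies.
    onEdge : ∀ v → (Σ (Fin n) (Adj v) → ℕ) → Fin n → ℕ
    onEdge v h u with T? (adjacent v u)
    ... | yes e = h (u , e)
    ... | no  _ = 0

    sum-ports : ∀ v (h : Σ (Fin n) (Adj v) → ℕ) →
      sum (λ p → h (Inverse.to (port v) p)) ≡ sum (onEdge v h)
    sum-ports v h = begin
      sum (λ p → h (Inverse.to (port v) p))   ≡⟨ sum-cong-≗ (λ p → sym (row p)) ⟩
      sum (λ p → sum (λ u → H p u))           ≡⟨ ∑-comm H ⟩
      sum (λ u → sum (λ p → H p u))           ≡⟨ sum-cong-≗ column ⟩
      sum (onEdge v h)                        ∎
      where
      open ≡-Reasoning
      H : Fin (degree v) → Fin n → ℕ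
      H p u = if does (neighbour v p ≟ᶠ u) then h (Inverse.to (port v) p) else 0
      row : ∀ p → sum (H p) ≡ h (Inverse.to (port v) p)
      row p = trans
        (sum-single (H p) (neighbour v p) λ u u≢ →
          if-no (neighbour v p ≟ᶠ u) (λ eq → u≢ (sym eq)))
        (if-yes (neighbour v p ≟ᶠ neighbour v p) refl)
      column : ∀ u → sum (λ p → H p u) ≡ onEdge v h u
      column u with T? (adjacent v u)
      ... | no ¬e = sum-zero λ p → if-no (neighbour v p ≟ᶠ u) (λ eq → ¬e (subst (Adj v) eq (neighbour-adjacent v p)))
      ... | yes e = begin
        sum (λ p → H p u)              ≡⟨ sum-single (λ p → H p u) q others ⟩
        H q u                          ≡⟨ if-yes (neighbour v q ≟ᶠ u) nb-q ⟩
        h (Inverse.to (port v) q)      ≡⟨ cong h (Inverse.strictlyInverseˡ (port v) (u , e)) ⟩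
        h (u , e)                      ∎
        where
        q = Inverse.from (port v) (u , e)
        nb-q : neighbour v q ≡ u
        nb-q = neighbour-from v (u , e)
        others : ∀ p → p ≢ q → H p u ≡ 0
        others p p≢q = if-no (neighbour v p ≟ᶠ u) (λ eq → p≢q (neighbour-injective v (trans eq (sym nb-q))))

  -- `back` permutes the half-edges, so what crosses the edges may be summed at the receivers or at
  -- the senders. Conservation of proposals and of counts rests on this.
  sum-halfEdges : ∀ (f : ∀ v → Fin (degree v) → ℕ) →
    sum (λ v → sum (λ p → f (neighbour v p) (back v p))) ≡ sum (λ u → sum (f u))
  sum-halfEdges f = begin
    sum (λ v → sum (λ p → f (neighbour v p) (back v p)))  ≡⟨ sum-cong-≗ (λ v → sum-ports v (incoming v)) ⟩
    sum (λ v → sum (onEdge v (incoming v)))               ≡⟨ ∑-comm (λ v u → onEdge v (incoming v) u) ⟩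
    sum (λ u → sum (λ v → onEdge v (incoming v) u))       ≡⟨ sum-cong-≗ (λ u → sum-cong-≗ (λ v → reverse u v)) ⟩
    sum (λ u → sum (onEdge u (outgoing u)))               ≡⟨ sum-cong-≗ (λ u → sym (sum-ports u (outgoing u))) ⟩
    sum (λ u → sum (λ p → outgoing u (Inverse.to (port u) p)))
      ≡⟨ sum-cong-≗ (λ u → sum-cong-≗ (λ p → cong (f u) (Inverse.strictlyInverseʳ (port u) p))) ⟩
    sum (λ u → sum (f u))                                 ∎
    where
    open ≡-Reasoning
    incoming outgoing : ∀ v → Σ (Fin n) (Adj v) → ℕ
    incoming v (u , e) = f u (Inverse.from (port u) (v , symmetric e))
    outgoing u z = f u (Inverse.from (port u) z)
    reverse : ∀ u v → onEdge v (incoming v) u ≡ onEdge u (outgoing u) v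
    reverse u v with T? (adjacent v u) | T? (adjacent u v)
    ... | yes e | yes e′ = cong (λ x → f u (Inverse.from (port u) (v , x))) (T-irrelevant _ _)
    ... | yes e | no ¬e  = contradiction (symmetric e) ¬e
    ... | no ¬e | yes e  = contradiction (symmetric e) ¬e
    ... | no _  | no _   = refl

-- The program of a node

smallestBelow : ∀ {d} → ℕ → (Fin d → ℕ) → Maybe (Fin d)
smallestBelow {zero}  k f = nothing
smallestBelow {suc d} k f with smallestBelow k (λ p → f (suc p))
... | just p with f zero ≤? f (suc p)
...   | yes _ = just zero
...   | no _  = just (suc p)
smallestBelow {suc d} k f | nothing with f zero <? k
...   | yes _ = just zero
...   | no _  = nothing

smallestBelow-nothing : ∀ {d} k (f : Fin d → ℕ) → smallestBelow k f ≡ nothing → ∀ q → k ≤ f q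
smallestBelow-nothing {suc d} k f eq q with smallestBelow k (λ p → f (suc p)) in eq′
smallestBelow-nothing {suc d} k f eq q | just p with f zero ≤? f (suc p)
smallestBelow-nothing {suc d} k f () q | just p | yes _
smallestBelow-nothing {suc d} k f () q | just p | no _
smallestBelow-nothing {suc d} k f eq q | nothing with f zero <? k
smallestBelow-nothing {suc d} k f () q | nothing | yes _
smallestBelow-nothing {suc d} k f eq zero    | nothing | no nlt = ≮⇒≥ nlt
smallestBelow-nothing {suc d} k f eq (suc q) | nothing | no _ =
  smallestBelow-nothing k (λ p → f (suc p)) eq′ q

smallestBelow-just : ∀ {d} k (f : Fin d → ℕ) {p} → smallestBelow k f ≡ just p →
  f p < k × ∀ q → f p ≤ f q
smallestBelow-just {suc d} k f eq with smallestBelow k (λ p → f (suc p)) in eq′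
smallestBelow-just {suc d} k f eq | just p with f zero ≤? f (suc p)
smallestBelow-just {suc d} k f refl | just p | yes le =
  ≤-<-trans le (proj₁ (smallestBelow-just k (λ p → f (suc p)) eq′)) ,
  λ { zero → ≤-refl ; (suc q) → ≤-trans le (proj₂ (smallestBelow-just k (λ p → f (suc p)) eq′) q) }
smallestBelow-just {suc d} k f refl | just p | no nle =
  proj₁ (smallestBelow-just k (λ p → f (suc p)) eq′) ,
  λ { zero → <⇒≤ (≰⇒> nle) ; (suc q) → proj₂ (smallestBelow-just k (λ p → f (suc p)) eq′) q }
smallestBelow-just {suc d} k f eq | nothing with f zero <? k
smallestBelow-just {suc d} k f refl | nothing | yes lt =
  lt , λ { zero → ≤-refl ; (suc q) → ≤-trans (<⇒≤ lt) (smallestBelow-nothing k (λ p → f (suc p)) eq′ q) }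
smallestBelow-just {suc d} k f () | nothing | no _

-- Positions past the end read alike for all identifiers, so all clusters of level `b` have equal
-- rank and attract no proposals from one another.
bitAt : ∀ {m} → Vec Bool m → ℕ → Bool
bitAt []       _       = true
bitAt (x ∷ xs) zero    = x
bitAt (x ∷ xs) (suc j) = bitAt xs j

bitAt-extensional : ∀ {m} (x y : Vec Bool m) → (∀ k → k < m → bitAt x k ≡ bitAt y k) → x ≡ y
bitAt-extensional []       []       _  = refl
bitAt-extensional (a ∷ xs) (c ∷ ys) eq = cong₂ _∷_ (eq 0 (s≤s z≤n)) (bitAt-extensional xs ys λ k k< → eq (suc k) (s≤s k<))

record Info : Set where
  constructor info
  field
    level tokens : ℕ
    stalled      : Bool
open Info public

-- `log R s` is the tree first entered at step `s`, with the port to the parent. A step brings a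
-- node into at most one tree, so the step can serve as the key, and it doubles as the time slot of
-- the edge. The tree that a node founded is in `member` but not in the log.
record Tree (Id : Set) (d : ℕ) : Set where
  constructor mkTree
  field
    member : List Id
    log    : ℕ → Maybe (Id × Fin d)
open Tree public

module Protocol (b K M : ℕ) where

  Id : Set
  Id = Vec Bool b

  _≟ⁱ_ : DecidableEquality Id
  _≟ⁱ_ = ≡-decᵛ _≟ᵇ_

  open DecMembership _≟ⁱ_ using (_∈?_)

  rank : Id → ℕ → ℕ
  rank i l = l * 2 + bit (not (bitAt i l))

  -- Without proposals the test fails as long as there are tokens: a cluster that nobody approaches
  -- stalls free of charge, and thereby rises.
  accepts : Info → ℕ → Bool
  accepts (info l t s) x with t ≤? x * K
  ... | yes _ = true
  ... | no _  = false

  charge : Info → ℕ → Info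
  charge (info l t s) x with t ≤? x * K
  ... | yes _ = info l (t + x) s
  ... | no  _ = info l (t ∸ x * (2 * M)) true

  -- A finished cluster, of level b, must not rise further: a cluster of larger
  -- rank would make its nodes propose again.
  bump : Bool → Info → Info
  bump false I            = I
  bump true  (info l t s) = info (if s then b ⊓ suc l else l) t false

  settle : Bool → Info → ℕ → Info
  settle e I x = bump e (charge I x)

  -- A node that returns to a tree keeps its first parent edge. This keeps parents unique and older
  -- than their children.
  joinTree : ∀ {d} → ℕ → Maybe (Id × Fin d) → Tree Id d → Tree Id d
  joinTree t nothing        R = R
  joinTree t (just (i , p)) R with i ∈? member R
  ... | yes _ = R
  ... | no  _ = mkTree (i ∷ member R) (λ s → if does (s ≟ t) then just (i , p) else log R s)

  -- `root` is the state of the cluster that this node founded, kept up even after the node has left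
  -- it or died. `acc` and `verdict` hold partial counts and known decisions by cluster; `asked s p`
  -- is the tree in which the neighbour behind `p` reported as a child in slot `s`.
  record Node (d : ℕ) : Set where
    field
      self    : Id
      cluster : Maybe (Id × ℕ)
      root    : Info
      tree    : Tree Id d
      target  : Maybe (Fin d)
      acc     : Id → ℕ
      asked   : ℕ → Fin d → Maybe Id
      verdict : Id → Bool × ℕ
  open Node public

  record Packet : Set where
    constructor packet
    field
      flag   : Bool
      ident  : Id
      -- One bit more than an identifier: the number may be a count of `n` proposals, and `n` may
      -- equal `2 ^ b`.
      number : Vec Bool (suc b)
  open Packet public

  blank : Packet
  blank = packet false (Vec.replicate b false) (Vec.replicate (suc b) false)

  data Instr : Set where
    announce propose : Instr
    up down resolve  : ℕ → Instr
    decide           : Bool → Instr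

  clusterId : ∀ {d} → Node d → Maybe Id
  clusterId x = Maybe.map proj₁ (cluster x)

  joined : ∀ {d} → Tree Id d → ℕ → Maybe Id
  joined R s = Maybe.map proj₁ (log R s)

  -- The tree in which p has led to the parent since step s.
  upward : ∀ {d} → Tree Id d → ℕ → Fin d → Maybe Id
  upward R s p = log R s >>= λ (i , q) → if does (q ≟ᶠ p) then just i else nothing

  _is_ : Maybe Id → Id → Bool
  j is i = does (≡-decᵐ _≟ⁱ_ j (just i))

  ruling : ∀ {d} → Node d → Id → Packet
  ruling x i = packet (proj₁ (verdict x i)) i (toBits (suc b) (proj₂ (verdict x i)))

  sendN : ∀ {d} → Instr → Node d → Fin d → Packet
  sendN announce    x p = maybe (λ (i , l) → packet true i (toBits (suc b) l)) blank (cluster x)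
  sendN propose     x p = record blank { flag = does (≡-decᵐ _≟ᶠ_ (target x) (just p)) }
  sendN (up s)      x p = maybe (λ i → packet true i (toBits (suc b) (acc x i))) blank (upward (tree x) s p)
  sendN (decide _)  x p = blank
  sendN (down s)    x p = maybe (ruling x) blank (asked x s p)
  sendN (resolve _) x p = maybe (ruling x) blank (clusterId x)

  -- A neighbour without a cluster is heard at the listener's own rank `k`, which is never strictly
  -- below `k`, so it is never chosen.
  heardRank : ℕ → Packet → ℕ
  heardRank k m = if flag m then rank (ident m) (fromBits (number m)) else k

  choose : ∀ {d} → (Fin d → Packet) → Id × ℕ → Maybe (Fin d)
  choose m (i , l) = smallestBelow (rank i l) (λ p → heardRank (rank i l) (m p))

  refresh : ∀ {d} → Node d → Maybe (Id × ℕ)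
  refresh x = Maybe.map (λ i → i , proj₂ (verdict x i)) (clusterId x)

  accepted : ∀ {d} → Fin d → Packet → Maybe (Id × Fin d)
  accepted p m = if flag m then just (ident m , p) else nothing

  recvN : ∀ {d} → Instr → Node d → (Fin d → Packet) → Node d
  recvN announce x m = record x { target = cluster x >>= choose m }
  recvN propose  x m = record x
    { acc = λ i → if clusterId x is i then sum (λ p → bit (flag (m p))) else 0 }
  recvN (up s) x m = record x
    { acc   = λ i → (if joined (tree x) s is i then 0 else acc x i)
                    + sum (λ p → if flag (m p) ∧ does (ident (m p) ≟ⁱ i) then fromBits (number (m p)) else 0)
    ; asked = λ r p → if does (r ≟ s) then (if flag (m p) then just (ident (m p)) else nothing) else asked x r p
    }
  recvN (decide e) x m = record x
    { root    = settle e (root x) (acc x (self x))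
    -- Only the entry of `self` is meaningful at this point; those of the other trees of the node
    -- are set by the `down` messages.
    ; verdict = λ _ → accepts (root x) (acc x (self x)) , level (settle e (root x) (acc x (self x)))
    }
  recvN (down s) x m with log (tree x) s
  ... | nothing      = x
  ... | just (i , p) = record x
    { verdict = λ j → if does (j ≟ⁱ i) then (flag (m p) , fromBits (number (m p))) else verdict x j }
  recvN (resolve t) x m with target x
  ... | nothing = record x { cluster = refresh x }
  ... | just p  = record x
    { cluster = if flag (m p) then just (ident (m p) , fromBits (number (m p))) else nothing
    ; tree    = joinTree t (accepted p (m p)) (tree x)
    }

  -- `ups` runs from recent edges to old ones, so a node has heard all its children in a tree before
  -- it reports to its parent. `downs` runs the other way, so a parent knows a verdict before it
  -- passes it on.
  ups downs : ℕ → List Instr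
  ups zero      = []
  ups (suc s)   = up s ∷ ups s
  downs zero    = []
  downs (suc s) = downs s ++ [ down s ]

  stepInstrs : ℕ → Bool → List Instr
  stepInstrs t e = announce ∷ propose ∷ ups t ++ decide e ∷ downs t ++ [ resolve t ]

  -- The closing `ups` tells parents about the edges created in the last step, since the output has
  -- to mark tree edges at both ends.
  schedule : ℕ → List Bool → List Instr
  schedule t []       = ups t
  schedule t (e ∷ es) = stepInstrs t e ++ schedule (suc t) es

  isZero : ℕ → Bool
  isZero zero    = true
  isZero (suc _) = false

  phase : ℕ → List Bool
  phase zero    = []
  phase (suc k) = isZero k ∷ phase k

  phases : ℕ → List Bool
  phases zero    = []
  phases (suc m) = phase K ++ phases m

  length-phase : ∀ k → length (phase k) ≡ k
  length-phase zero    = refl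
  length-phase (suc k) = cong suc (length-phase k)

  length-phases : ∀ m → length (phases m) ≡ m * K
  length-phases zero    = refl
  length-phases (suc m) = trans (length-++ (phase K)) (cong₂ _+_ (length-phase K) (length-phases m))

  initNode : ∀ d → LocalInput b → Node d
  initNode d (localInput i living) = record
    { self    = i
    ; cluster = if living then just (i , 0) else nothing
    ; root    = info 0 1 false
    ; tree    = mkTree [ i ] (λ _ → nothing)
    ; target  = nothing
    ; acc     = λ _ → 0
    ; asked   = λ _ _ → nothing
    ; verdict = λ _ → false , 0
    }

  IsEdge : ∀ {d} → Node d → Id → Fin d → ℕ → Set
  IsEdge x i p s = upward (tree x) s p ≡ just i ⊎ asked x s p ≡ just i

  edge? : ∀ {d} (x : Node d) i p s → Dec (IsEdge x i p s)
  edge? x i p s = ≡-decᵐ _≟ⁱ_ (upward (tree x) s p) (just i) ⊎-dec ≡-decᵐ _≟ⁱ_ (asked x s p) (just i)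

  edges : ∀ {d} → ℕ → Node d → Id → Subset d
  edges T x i = tabulate λ p → does (anyUpTo? (edge? x i p) T)

  outputNode : ∀ {d} → ℕ → Node d → LocalOutput d
  outputNode T x = record
    { cluster = Maybe.map fromBits (clusterId x)
    ; trees   = List.map (λ i → fromBits i , edges T x i) (member (tree x))
    }

  -- Packets as bit strings

  pack : Packet → Vec Bool (suc (b + suc b))
  pack (packet f i x) = f ∷ i Vec.++ x

  unpack : Vec Bool (suc (b + suc b)) → Packet
  unpack (f ∷ v) = packet f (Vec.take b v) (Vec.drop b v)

  unpack-pack : ∀ m → unpack (pack m) ≡ m
  unpack-pack (packet f i x) with ++-injective (Vec.take b (i Vec.++ x)) i (take++drop≡id b (i Vec.++ x))
  ... | eq , eq′ = cong₂ (packet f) eq eq′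

  module Compiled {w : ℕ} (fits : suc (b + suc b) ≤ w) where

    encode : Packet → Vec≤ Bool w
    encode m = record { vec = pack m ; bound = fits }

    -- `Vec≤` hides the length of a message, hence the test; whatever `encode` produces passes it.
    decodeVec : ∀ {k} → Vec Bool k → Packet
    decodeVec {k} v with k ≟ suc (b + suc b)
    ... | yes refl = unpack v
    ... | no _     = blank

    decode : Vec≤ Bool w → Packet
    decode m = decodeVec (Vec≤.vec m)

    decode-encode : ∀ m → decode (encode m) ≡ m
    decode-encode m with suc (b + suc b) ≟ suc (b + suc b)
    ... | yes refl = unpack-pack m
    ... | no ne    = contradiction refl ne

    perform : ∀ {d} → List Instr × Node d → (Fin d → Vec≤ Bool w) → List Instr × Node d
    perform ([]     , x) _ = [] , x
    perform (c ∷ cs , x) m = cs , recvN c x (λ p → decode (m p))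

    emit : ∀ {d} → List Instr × Node d → Fin d → Vec≤ Bool w
    emit ([]    , x) p = encode blank
    emit (c ∷ _ , x) p = encode (sendN c x p)

    algorithm : List Bool → Algorithm w (LocalInput b) LocalOutput
    algorithm es = record
      { State   = λ d → List Instr × Node d
      ; init    = λ d input → schedule 0 es , initNode d input
      ; send    = emit
      ; receive = perform
      ; rounds  = length (schedule 0 es)
      ; output  = λ (_ , x) → outputNode (length es) x
      }

  -- Synchronous rounds of the whole network

  module Global {n : ℕ} {G : Graph n} (P : PortNumbering G) where
    open PortNumbering P
    open Network P

    Nodes : Set
    Nodes = ∀ v → Node (degree v)

    -- Stated pointwise: without function extensionality an inbox can only be
    -- described message by message.
    record Round (c : Instr) (X Y : Nodes) : Set where
      field
        inbox    : ∀ v → Fin (degree v) → Packet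
        received : ∀ v p → inbox v p ≡ sendN c (X (neighbour v p)) (back v p)
        becomes  : ∀ v → Y v ≡ recvN c (X v) (inbox v)

    data Rounds : List Instr → Nodes → Nodes → Set where
      []  : ∀ {X} → Rounds [] X X
      _∷_ : ∀ {c cs X Y Z} → Round c X Y → Rounds cs Y Z → Rounds (c ∷ cs) X Z

    split : ∀ cs {ds X Z} → Rounds (cs ++ ds) X Z → ∃[ Y ] Rounds cs X Y × Rounds ds Y Z
    split []       rs       = _ , [] , rs
    split (c ∷ cs) (r ∷ rs) with split cs rs
    ... | Y , rs₁ , rs₂ = Y , r ∷ rs₁ , rs₂

    module Run {w : ℕ} (fits : suc (b + suc b) ≤ w) (es : List Bool) (input : Fin n → LocalInput b) where
      open Compiled fits
      open Execution (algorithm es) P input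

      nodes : ℕ → Nodes
      nodes t v = proj₂ (stateAfter t v)

      messages : ℕ → ∀ v → Fin (degree v) → Vec≤ Bool w
      messages t v p = emit (stateAfter t (neighbour v p)) (back v p)

      -- The remaining instructions are part of each state but evolve independently of inputs and
      -- messages; carrying the hypothesis that all nodes hold the same `cs` keeps the network in
      -- step.
      rounds-from : ∀ t cs → (∀ v → proj₁ (stateAfter t v) ≡ cs) →
        Rounds cs (nodes t) (nodes (length cs + t))
      rounds-from t []       _  = []
      rounds-from t (c ∷ cs) pc = record
        { inbox    = λ v p → decode (messages t v p)
        ; received = λ v p → trans (cong (λ z → decode (emit (z , nodes t (neighbour v p)) (back v p))) (pc (neighbour v p)))
                                   (decode-encode _)
        ; becomes  = λ v → cong (λ z → proj₂ (perform (z , nodes t v) (messages t v))) (pc v)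
        } ∷ subst (λ k → Rounds cs (nodes (suc t)) (nodes k)) (+-suc-length cs)
              (rounds-from (suc t) cs λ v → cong (λ z → proj₁ (perform (z , nodes t v) (messages t v))) (pc v))
        where
        open import Data.Nat.Properties using (+-suc)
        +-suc-length : ∀ (cs : List Instr) → length cs + suc t ≡ suc (length cs + t)
        +-suc-length cs = +-suc (length cs) t

      final : Nodes
      final = nodes (length (schedule 0 es))

      rounds : Rounds (schedule 0 es) (λ v → initNode (degree v) (input v)) final
      rounds = subst (λ k → Rounds (schedule 0 es) (nodes 0) (nodes k)) (+-identityʳ (length (schedule 0 es)))
        (rounds-from 0 (schedule 0 es) λ _ → refl)
        where open import Data.Nat.Properties using (+-identityʳ)

-- Walks and cycles

unique-length : ∀ {A : Set} {xs ys : List A} → Unique xs → All (_∈ ys) xs → length xs ≤ length ys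
unique-length {xs = []} _ _ = z≤n
unique-length {xs = x ∷ xs} (x≢ ∷ uniq) (x∈ ∷ xs∈) with ∈-∃++ x∈
... | as , bs , refl = begin
  suc (length xs)               ≤⟨ s≤s (unique-length uniq (All.zipWith elsewhere (x≢ , xs∈))) ⟩
  suc (length (as ++ bs))       ≡⟨ cong suc (length-++ as) ⟩
  suc (length as + length bs)   ≡⟨ sym (+-suc (length as) (length bs)) ⟩
  length as + suc (length bs)   ≡⟨ sym (length-++ as) ⟩
  length (as ++ x ∷ bs)         ∎
  where
  open ≤-Reasoning
  elsewhere : ∀ {y} → x ≢ y × y ∈ as ++ x ∷ bs → y ∈ as ++ bs
  elsewhere (x≢y , y∈) with ∈-++⁻ as y∈
  ... | inj₁ y∈as         = ∈-++⁺ˡ y∈as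
  ... | inj₂ (here refl)  = contradiction refl x≢y
  ... | inj₂ (there y∈bs) = ∈-++⁺ʳ as y∈bs

_++ʷ_ : ∀ {A : Set} {E : Rel A 0ℓ} {k l u v w} → Walk E k u v → Walk E l v w → Walk E (k + l) u w
here     ++ʷ q = q
step e p ++ʷ q = step e (p ++ʷ q)

mapʷ : ∀ {A : Set} {E F : Rel A 0ℓ} {k u v} → (∀ {x y} → E x y → F x y) → Walk E k u v → Walk F k u v
mapʷ f here       = here
mapʷ f (step e p) = step (f e) (mapʷ f p)

reverseʷ : ∀ {A : Set} {E : Rel A 0ℓ} → (∀ {x y} → E x y → E y x) → ∀ {k u v} → Walk E k u v → Walk E k v u
reverseʷ sym-E here = here
reverseʷ {E = E} sym-E {suc k} {u} {v} (step e p) =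
  subst (λ l → Walk E l v u) (+-comm k 1) (reverseʷ sym-E p ++ʷ step (sym-E e) here)

module _ {A : Set} {E Parent : Rel A 0ℓ} (height : A → ℕ)
  (orient : ∀ {x y} → E x y → Parent x y ⊎ Parent y x)
  (parent-unique : ∀ {x y z} → Parent x y → Parent x z → y ≡ z)
  (parent-lower : ∀ {x y} → Parent x y → height y < height x) where

  private
    -- A walk that does not turn back keeps descending once it has gone from a
    -- node to a child.
    descend : ∀ x y l z → Parent y x → Unique (x ∷ y ∷ l) → z ≢ x → All (z ≢_) (y ∷ l) → Linked E (y ∷ l ++ [ z ]) →
      height x < height z × (∃[ w ] w ∈ y ∷ l × Parent z w)
    descend x y [] z y→x _ z≢x _ (e ∷ _) with orient e
    ... | inj₁ y→z = contradiction (parent-unique y→z y→x) z≢x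
    ... | inj₂ z→y = <-trans (parent-lower y→x) (parent-lower z→y) , y , here refl , z→y
    descend x y (w ∷ l) z y→x ((x≢y ∷ x≢w ∷ x≢l) ∷ uniq) z≢x (z≢y ∷ z≢l) (e ∷ es) with orient e
    ... | inj₁ y→w = contradiction (parent-unique y→x y→w) x≢w
    ... | inj₂ w→y with descend y w l z w→y uniq z≢y z≢l es
    ...   | lt , w′ , w′∈ , z→w′ = <-trans (parent-lower y→x) lt , w′ , there w′∈ , z→w′

    ascend : ∀ y l z → Unique (y ∷ l) → All (z ≢_) (y ∷ l) → Linked E (y ∷ l ++ [ z ]) →
      height z < height y ⊎ (∃[ w ] w ∈ y ∷ l × Parent z w)
    ascend y [] z _ _ (e ∷ _) with orient e
    ... | inj₁ y→z = inj₁ (parent-lower y→z)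
    ... | inj₂ z→y = inj₂ (y , here refl , z→y)
    ascend y (w ∷ l) z (y≢ ∷ uniq) (z≢y ∷ z≢l) (e ∷ es) with orient e
    ... | inj₂ w→y with descend y w l z w→y (y≢ ∷ uniq) z≢y z≢l es
    ...   | _ , w′ , w′∈ , z→w′ = inj₂ (w′ , there w′∈ , z→w′)
    ascend y (w ∷ l) z (y≢ ∷ uniq) (z≢y ∷ z≢l) (e ∷ es) | inj₁ y→w with ascend w l z uniq z≢l es
    ... | inj₁ lt = inj₁ (<-trans lt (parent-lower y→w))
    ... | inj₂ (w′ , w′∈ , z→w′) = inj₂ (w′ , there w′∈ , z→w′)

  -- A cycle that starts towards a child must descend all the way back to `v`, which the heights
  -- forbid. One that starts towards the parent `y` either ascends throughout, again against the
  -- heights, or returns to `v` from a parent of `v` later on the cycle, a second parent besides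
  -- `y`.
  forest-acyclic : ∀ {v vs} → ¬ IsCycle E v vs
  forest-acyclic {v} {[]}    (() , _)
  forest-acyclic {v} {_ ∷ []} (s≤s () , _)
  forest-acyclic {v} {y ∷ w ∷ l} (_ , ((v≢y ∷ v≢w ∷ v≢l) ∷ uniq@(y≢ ∷ uniq′)) , e ∷ e′ ∷ es) with orient e | orient e′
  ... | inj₂ y→v | inj₁ y→w = contradiction (parent-unique y→v y→w) v≢w
  ... | inj₂ y→v | inj₂ w→y = <-asym (parent-lower y→v)
          (proj₁ (descend y w l v w→y uniq v≢y (v≢w ∷ v≢l) es))
  ... | inj₁ v→y | inj₂ w→y with descend y w l v w→y uniq v≢y (v≢w ∷ v≢l) es
  ...   | _ , w′ , w′∈ , v→w′ = All.lookup y≢ w′∈ (parent-unique v→y v→w′)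
  forest-acyclic {v} {y ∷ w ∷ l} (_ , ((v≢y ∷ v≢w ∷ v≢l) ∷ uniq@(y≢ ∷ uniq′)) , e ∷ e′ ∷ es)
    | inj₁ v→y | inj₁ y→w with ascend w l v uniq′ (v≢w ∷ v≢l) es
  ... | inj₁ lt = <-irrefl refl (<-trans lt (<-trans (parent-lower y→w) (parent-lower v→y)))
  ... | inj₂ (w′ , w′∈ , v→w′) = All.lookup y≢ w′∈ (parent-unique v→y v→w′)

-- The carving process, seen globally

module Carving (b K M : ℕ) {n : ℕ} {G : Graph n} (P : PortNumbering G)
  (identifier : Fin n → Vec Bool b) (identifier-injective : Injective _≡_ _≡_ identifier)
  (S : Subset n) (K≥4M : 4 * M ≤ K) (K>0 : 0 < K) where

  open Graph G
  open PortNumbering P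
  open Network P
  open Protocol b K M
  open Global P
  open DecMembership _≟ⁱ_ using (_∈?_)

  -- The component `moves` has no counterpart in a node. It serves the analysis, where it pays for
  -- ranks, tokens and tree memberships.
  record Config : Set where
    field
      home  : Fin n → Maybe Id
      state : Id → Info
      trees : ∀ v → Tree Id (degree v)
      moves : Fin n → ℕ
  open Config public

  rankIn : Config → Id → ℕ
  rankIn C i = rank i (level (state C i))

  Targets : Set
  Targets = ∀ v → Maybe (Fin (degree v))

  -- Ties among clusters of least rank are left open, so the analysis does not depend on the port
  -- numbering.
  record Valid (C : Config) (tgt : Targets) : Set where
    field
      proposes : ∀ v {p} → tgt v ≡ just p → ∃[ j ] ∃[ i ] home C v ≡ just j × home C (neighbour v p) ≡ just i
                 × rankIn C i < rankIn C j × (∀ q {r} → home C (neighbour v q) ≡ just r → rankIn C i ≤ rankIn C r)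
      content  : ∀ v {j} → tgt v ≡ nothing → home C v ≡ just j →
                 ∀ q {r} → home C (neighbour v q) ≡ just r → rankIn C j ≤ rankIn C r

  module Step (C : Config) (tgt : Targets) where

    goal : Fin n → Maybe Id
    goal v = tgt v >>= λ p → home C (neighbour v p)

    demand : Id → ℕ
    demand i = sum λ v → bit (goal v is i)

    admits : Id → Bool
    admits i = accepts (state C i) (demand i)

    move : ∀ v → Maybe (Id × Fin (degree v))
    move v = entry (tgt v) (goal v)
      where
      entry : ∀ {d} → Maybe (Fin d) → Maybe Id → Maybe (Id × Fin d)
      entry (just p) (just i) = if admits i then just (i , p) else nothing
      entry _        _        = nothing

    advance : ℕ → Config
    advance t = record
      { home  = λ v → maybe (λ i → if admits i then just i else nothing) (home C v) (goal v)
      ; state = λ i → charge (state C i) (demand i)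
      ; trees = λ v → joinTree t (move v) (trees C v)
      ; moves = λ v → moves C v + maybe (λ i → bit (admits i)) 0 (goal v)
      }

    data Fate (t : ℕ) (v : Fin n) : Set where
      stays : tgt v ≡ nothing → goal v ≡ nothing → move v ≡ nothing → Fate t v
      joins : ∀ {p i} → tgt v ≡ just p → home C (neighbour v p) ≡ just i → goal v ≡ just i →
              admits i ≡ true → move v ≡ just (i , p) → home (advance t) v ≡ just i → Fate t v
      dies  : ∀ {p i} → tgt v ≡ just p → home C (neighbour v p) ≡ just i → goal v ≡ just i →
              admits i ≡ false → move v ≡ nothing → home (advance t) v ≡ nothing → Fate t v

    goal-nothing : ∀ {v} → tgt v ≡ nothing → goal v ≡ nothing
    goal-nothing eq rewrite eq = refl

    move-nothing : ∀ {v} → tgt v ≡ nothing → move v ≡ nothing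
    move-nothing eq rewrite eq = refl

    module _ {v p i} (eq : tgt v ≡ just p) (eqi : home C (neighbour v p) ≡ just i) where

      goal-just : goal v ≡ just i
      goal-just rewrite eq = eqi

      move-just : ∀ {a} → admits i ≡ a → move v ≡ (if a then just (i , p) else nothing)
      move-just eqa rewrite sym eqa | goal-just | eq = refl

      home-just : ∀ {t a} → admits i ≡ a → home (advance t) v ≡ (if a then just i else nothing)
      home-just eqa rewrite sym eqa | goal-just = refl

    module _ (ok : Valid C tgt) where
      open Valid ok

      fate : ∀ t v → Fate t v
      fate t v with tgt v in eq
      ... | nothing = stays eq (goal-nothing eq) (move-nothing eq)
      ... | just p with home C (neighbour v p) in eqi
      ...   | nothing with proposes v eq
      ...     | _ , _ , _ , h , _ = contradiction (trans (sym eqi) h) λ ()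
      fate t v | just p | just i with admits i in eqa
      ... | true  = joins eq eqi (goal-just eq eqi) eqa (move-just eq eqi eqa) (home-just eq eqi {t} eqa)
      ... | false = dies eq eqi (goal-just eq eqi) eqa (move-just eq eqi eqa) (home-just eq eqi {t} eqa)

  bumped : Bool → Config → Config
  bumped e C = record C { state = λ i → bump e (state C i) }

  next : ℕ → Bool → (C : Config) → Targets → Config
  next t e C tgt = bumped e (Step.advance C tgt t)

  -- A level weighs 2 in the rank, the bit at most 1.
  rank-level : ∀ {i j l m} → rank i l ≤ rank j m → l ≤ m
  rank-level {i} {j} {l} {m} le = ≮⇒≥ λ m<l → <-irrefl refl (begin-strict
    rank j m     ≤⟨ +-monoʳ-≤ (m * 2) (bit≤1 _) ⟩
    m * 2 + 1    ≡⟨ +-comm (m * 2) 1 ⟩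
    1 + m * 2    <⟨ n<1+n _ ⟩
    suc m * 2    ≤⟨ *-monoˡ-≤ 2 m<l ⟩
    l * 2        ≤⟨ m≤m+n _ _ ⟩
    rank i l     ≤⟨ le ⟩
    rank j m     ∎)
    where open ≤-Reasoning

  rank-bit : ∀ {i j l} → rank i l ≤ rank j l → rank j l ≤ rank i l → bitAt i l ≡ bitAt j l
  rank-bit {i} {j} {l} le ge = not-bit (+-cancelˡ-≡ (l * 2) _ _ (≤-antisym le ge))
    where
    not-bit : ∀ {x y} → bit (not x) ≡ bit (not y) → x ≡ y
    not-bit {true}  {true}  _ = refl
    not-bit {false} {false} _ = refl

  level-charge : ∀ I x → level (charge I x) ≡ level I
  level-charge (info l t s) x with t ≤? x * K
  ... | yes _ = refl
  ... | no  _ = refl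

  charge-accept : ∀ I x → accepts I x ≡ true → stalled (charge I x) ≡ stalled I
  charge-accept (info l t s) x acc with t ≤? x * K
  ... | yes _ = refl

  price≤K : ∀ x → x * (2 * M) ≤ x * K
  price≤K x = *-monoʳ-≤ x (≤-trans (*-monoˡ-≤ M (s≤s (s≤s (z≤n {2})))) K≥4M)

  -- The price stands on the left to avoid truncated subtraction. A refusing cluster can afford it:
  -- `x * (2 * M) ≤ x * K < tokens I`.
  charge-balance : ∀ I x → tokens (charge I x) + x * (2 * M) * bit (not (accepts I x)) ≡ tokens I + x * bit (accepts I x)
  charge-balance (info l t s) x with t ≤? x * K
  ... | yes _ = trans (cong (t + x +_) (*-zeroʳ (x * (2 * M)))) (trans (+-identityʳ _) (cong (t +_) (sym (*-identityʳ x))))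
  ... | no t≰ = trans (cong (t ∸ x * (2 * M) +_) (*-identityʳ _))
                  (trans (m∸n+n≡m (≤-trans (price≤K x) (<⇒≤ (≰⇒> t≰)))) (trans (sym (+-identityʳ t)) (cong (t +_) (sym (*-zeroʳ x)))))

  -- A cluster that stalls at level l has seen at least i ∸ l doublings and at
  -- most l halvings when phase i starts; j counts the steps since then.
  record Growth (i j : ℕ) (I : Info) : Set where
    field
      growing : stalled I ≡ false → 2 ^ i ≤ tokens I * 4 ^ level I × 2 ^ i * (K + j) ≤ tokens I * 4 ^ level I * K
      halved  : stalled I ≡ true  → 2 ^ i ≤ 2 * (tokens I * 4 ^ level I)

  -- An accepting step brings in at least `t / K` tokens, and `t * 4 ^ l` is at least `2 ^ i`, which
  -- yields the further `2 ^ i` demanded by `suc j`. The hypothesis on stalled clusters ensures that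
  -- a cluster pays at most once per phase.
  growth-charge : ∀ {i j} I x → (stalled I ≡ true → x ≡ 0) → Growth i j I → Growth i (suc j) (charge I x)
  growth-charge {i} {j} (info l t s) x idle g with t ≤? x * K
  growth-charge {i} {j} (info l t s) x idle g | yes t≤ = record
    { growing = λ eq →
        ≤-trans (proj₁ (Growth.growing g eq)) (*-monoˡ-≤ (4 ^ l) (m≤m+n t x)) ,
        (begin
          2 ^ i * (K + suc j)                  ≡⟨ trans (cong (2 ^ i *_) (+-suc K j)) (*-suc (2 ^ i) (K + j)) ⟩
          2 ^ i + 2 ^ i * (K + j)              ≤⟨ +-mono-≤ (proj₁ (Growth.growing g eq)) (proj₂ (Growth.growing g eq)) ⟩
          t * 4 ^ l + t * 4 ^ l * K            ≤⟨ +-monoˡ-≤ _ (*-monoˡ-≤ (4 ^ l) t≤) ⟩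
          x * K * 4 ^ l + t * 4 ^ l * K        ≡⟨ regroup x t K (4 ^ l) ⟩
          (t + x) * 4 ^ l * K                  ∎)
    ; halved = λ eq → ≤-trans (Growth.halved g eq) (*-monoʳ-≤ 2 (*-monoˡ-≤ (4 ^ l) (m≤m+n t x)))
    }
    where
    open ≤-Reasoning
    regroup : ∀ x t k a → x * k * a + t * a * k ≡ (t + x) * a * k
    regroup = solve-∀
  growth-charge {i} {j} (info l t true) x idle g | no t≰ = record
    { growing = λ ()
    ; halved  = λ eq → subst (λ z → 2 ^ i ≤ 2 * ((t ∸ z * (2 * M)) * 4 ^ l)) (sym (idle refl)) (Growth.halved g refl)
    }
  growth-charge {i} {j} (info l t false) x idle g | no t≰ = record
    { growing = λ ()
    ; halved  = λ _ → begin
        2 ^ i                                     ≤⟨ proj₁ (Growth.growing g refl) ⟩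
        t * 4 ^ l                                 ≤⟨ *-monoˡ-≤ (4 ^ l) half ⟩
        2 * (t ∸ x * (2 * M)) * 4 ^ l             ≡⟨ *-assoc 2 (t ∸ x * (2 * M)) (4 ^ l) ⟩
        2 * ((t ∸ x * (2 * M)) * 4 ^ l)           ∎
    }
    where
    open ≤-Reasoning
    price : ∀ x m → x * (4 * m) ≡ 2 * (x * (2 * m))
    price = solve-∀
    double : ∀ t → 2 * t ≡ t + t
    double = solve-∀
    half : t ≤ 2 * (t ∸ x * (2 * M))
    half = begin
      t                                ≡⟨ sym (m+n∸n≡m t t) ⟩
      t + t ∸ t                        ≤⟨ ∸-monoʳ-≤ (t + t) (<⇒≤ (≰⇒> t≰)) ⟩
      t + t ∸ x * K                    ≤⟨ ∸-monoʳ-≤ (t + t) (*-monoʳ-≤ x K≥4M) ⟩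
      t + t ∸ x * (4 * M)              ≡⟨ cong₂ _∸_ (sym (double t)) (price x M) ⟩
      2 * t ∸ 2 * (x * (2 * M))        ≡⟨ sym (*-distribˡ-∸ 2 t (x * (2 * M))) ⟩
      2 * (t ∸ x * (2 * M))            ∎

  -- At `j = K` the growing inequality reads `2 ^ i * (K + K)`, which is the doubling. A stalled
  -- cluster is short of a factor 4, and the rise by one level supplies it; below `b` the cap in
  -- `bump` has no effect.
  growth-bump : ∀ {i} I → level (bump true I) < b → Growth i K I → Growth (suc i) 0 (bump true I)
  growth-bump {i} (info l t s) lt g = record
    { growing = λ _ → double , ≤-trans (≤-reflexive (cong (2 ^ suc i *_) (+-identityʳ K))) (*-monoˡ-≤ K double)
    ; halved  = λ ()
    }
    where
    open ≤-Reasoning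
    regroup : ∀ a → 2 * (2 * a) ≡ 4 * a
    regroup = solve-∀
    regroup′ : ∀ t a → 4 * (t * a) ≡ t * (4 * a)
    regroup′ = solve-∀
    regroup″ : ∀ p k → p * (k + k) ≡ 2 * p * k
    regroup″ = solve-∀
    doubling : ∀ s → Growth i K (info l t s) → level (bump true (info l t s)) < b →
      2 ^ suc i ≤ t * 4 ^ level (bump true (info l t s))
    doubling false g _ = *-cancelʳ-≤ _ _ K {{>-nonZero K>0}} (begin
      2 ^ suc i * K     ≡⟨ sym (regroup″ (2 ^ i) K) ⟩
      2 ^ i * (K + K)   ≤⟨ proj₂ (Growth.growing g refl) ⟩
      t * 4 ^ l * K     ∎)
    doubling true g lt = begin
      2 * 2 ^ i                    ≤⟨ *-monoʳ-≤ 2 (Growth.halved g refl) ⟩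
      2 * (2 * (t * 4 ^ l))        ≡⟨ trans (regroup (t * 4 ^ l)) (regroup′ t (4 ^ l)) ⟩
      t * 4 ^ suc l                ≡⟨ cong (λ k → t * 4 ^ k) (sym b⊓) ⟩
      t * 4 ^ (b ⊓ suc l)          ∎
      where
      b⊓ : b ⊓ suc l ≡ suc l
      b⊓ with ≤-total b (suc l)
      ... | inj₁ le = contradiction (subst (_< b) (m≤n⇒m⊓n≡m le) lt) (<-irrefl refl)
      ... | inj₂ ge = m≥n⇒m⊓n≡n ge
    double = doubling s g lt

  -- Invariants of the carving process

  living : Fin n → ℕ
  living v = bit (lookup S v)

  lost : Config → Fin n → ℕ
  lost C v = living v * maybe (λ _ → 0) (2 * M) (home C v)

  -- Clusters are summed through their founders in `S`, each of which founds exactly one.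
  wealth : Config → ℕ
  wealth C = sum λ r → living r * tokens (state C (identifier r))

  -- The invariant holds after `i` phases and `j` further steps. `growth` stops at level `b`: a
  -- finished cluster has the largest possible rank, so it receives no proposals and neither gains
  -- tokens nor rises.
  record Invariant (i j : ℕ) (C : Config) : Set where
    field
      founded   : ∀ v {r} → home C v ≡ just r → ∃[ u ] lookup S u ≡ true × identifier u ≡ r
      separated : ∀ {u v r q} → Adj u v → home C u ≡ just r → home C v ≡ just q →
                  ∀ k → k < level (state C r) → k < level (state C q) → bitAt r k ≡ bitAt q k
      topmost   : ∀ {u v r q} → Adj u v → home C u ≡ just r → home C v ≡ just q →
                  stalled (state C r) ≡ true → rankIn C q ≤ rankIn C r
      level≤b   : ∀ r → level (state C r) ≤ b
      potential : ∀ v {r} → home C v ≡ just r → moves C v + rankIn C r ≤ 3 * i + 1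
      moves≤    : ∀ v → moves C v ≤ 3 * i + 1
      outside   : ∀ v → lookup S v ≡ false → home C v ≡ nothing × moves C v ≡ 0
      budget    : wealth C + sum (lost C) ≤ ∣ S ∣ + sum (moves C)
      growth    : ∀ r → level (state C r) < b → Growth i j (state C r)

  module Advance {i j : ℕ} {C : Config} {tgt : Targets} (ok : Valid C tgt) (inv : Invariant i j C) (t : ℕ) where
    open Step C tgt
    open Invariant inv
    open Valid ok

    C′ : Config
    C′ = advance t

    level-same : ∀ r → level (state C′ r) ≡ level (state C r)
    level-same r = level-charge (state C r) (demand r)

    rank-same : ∀ r → rankIn C′ r ≡ rankIn C r
    rank-same r = cong (rank r) (level-same r)

    goal-source : ∀ v {r} → goal v ≡ just r →
      ∃[ p ] ∃[ m ] home C v ≡ just m × home C (neighbour v p) ≡ just r × rankIn C r < rankIn C m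
    goal-source v eq with fate ok t v
    ... | stays _ g _ = contradiction (trans (sym g) eq) λ ()
    ... | joins {p} tg hp g _ _ _ with proposes v tg | just-injective (trans (sym g) eq)
    ...   | m , _ , hv , hp′ , lt , _ | refl with just-injective (trans (sym hp) hp′)
    ...     | refl = p , m , hv , hp′ , lt
    goal-source v eq | dies {p} tg hp g _ _ _ with proposes v tg | just-injective (trans (sym g) eq)
    ...   | m , _ , hv , hp′ , lt , _ | refl with just-injective (trans (sym hp) hp′)
    ...     | refl = p , m , hv , hp′ , lt

    not-stalled : ∀ v p {r m} → home C v ≡ just m → home C (neighbour v p) ≡ just r → rankIn C r < rankIn C m →
      stalled (state C r) ≢ true
    not-stalled v p hv hp lt st = <-irrefl refl (<-≤-trans lt (topmost (symmetric (neighbour-adjacent v p)) hp hv st))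

    -- A proposer has larger rank than its goal, which `topmost` excludes next to a stalled cluster.
    idle : ∀ {r} → stalled (state C r) ≡ true → demand r ≡ 0
    idle {r} st = sum-zero λ v → cong bit (dec-false (≡-decᵐ _≟ⁱ_ (goal v) (just r)) λ g →
      let p , _ , hv , hp , lt = goal-source v g in not-stalled v p hv hp lt st)

    data Origin (v : Fin n) (r : Id) : Set where
      old : home C v ≡ just r → Origin v r
      new : ∀ {p m} → home C v ≡ just m → home C (neighbour v p) ≡ just r →
            rankIn C r < rankIn C m → admits r ≡ true → Origin v r

    origin : ∀ v {r} → home C′ v ≡ just r → Origin v r
    origin v eq with fate ok t v
    ... | stays _ g _ = old (trans (sym (cong (maybe _ (home C v)) g)) eq)
    ... | dies _ _ _ _ _ h = contradiction (trans (sym h) eq) λ ()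
    ... | joins {p} tg hp g acc _ h with proposes v tg | just-injective (trans (sym h) eq)
    ...   | m , m′ , hv , hp′ , lt , _ | refl with just-injective (trans (sym hp) hp′)
    ...     | refl = new hv hp lt acc

    -- Whoever moved went to a cluster of least rank around, and whoever did not propose saw nothing
    -- below its own rank. The comparison is with the old clusters of the neighbours; `topmost′` has
    -- to bridge that gap.
    lowest : ∀ v {q} → home C′ v ≡ just q → ∀ p {r} → home C (neighbour v p) ≡ just r → rankIn C q ≤ rankIn C r
    lowest v eq p hr with fate ok t v
    ... | stays tg g _ = content v tg (trans (sym (cong (maybe _ (home C v)) g)) eq) p hr
    ... | dies _ _ _ _ _ h = contradiction (trans (sym h) eq) λ ()
    ... | joins tg hp g acc _ h with proposes v tg | just-injective (trans (sym h) eq)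
    ...   | m , m′ , hv , hp′ , _ , least | refl with just-injective (trans (sym hp) hp′)
    ...     | refl = least p hr

    -- A move follows an edge, along which the bits already agree, and goes to a level no higher. So
    -- the new cluster of a node can be compared with others through its old one.
    agreeing : ∀ v {r} → home C′ v ≡ just r → ∃[ m ] home C v ≡ just m × level (state C r) ≤ level (state C m)
      × (∀ k → k < level (state C r) → bitAt r k ≡ bitAt m k)
    agreeing v {r} eq with origin v eq
    ... | old h = _ , h , ≤-refl , λ _ _ → refl
    ... | new {p} {m} hv hp lt _ = m , hv , le ,
          λ k k< → separated (symmetric (neighbour-adjacent v p)) hp hv k k< (<-≤-trans k< le)
      where le = rank-level {r} {m} (<⇒≤ lt)

    founded′ : ∀ v {r} → home C′ v ≡ just r → ∃[ u ] lookup S u ≡ true × identifier u ≡ r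
    founded′ v eq with origin v eq
    ... | old h = founded v h
    ... | new {p} _ hp _ _ = founded (neighbour v p) hp

    separated′ : ∀ {u v r q} → Adj u v → home C′ u ≡ just r → home C′ v ≡ just q →
      ∀ k → k < level (state C′ r) → k < level (state C′ q) → bitAt r k ≡ bitAt q k
    separated′ {u} {v} {r} {q} e hu hv k k<r k<q
      with agreeing u hu | agreeing v hv | subst (k <_) (level-same r) k<r | subst (k <_) (level-same q) k<q
    ... | m , hm , le , agree | m′ , hm′ , le′ , agree′ | lt | lt′ =
      trans (agree k lt) (trans (separated e hm hm′ k (<-≤-trans lt le) (<-≤-trans lt′ le′)) (sym (agree′ k lt′)))

    topmost′ : ∀ {u v r q} → Adj u v → home C′ u ≡ just r → home C′ v ≡ just q →
      stalled (state C′ r) ≡ true → rankIn C′ q ≤ rankIn C′ r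
    topmost′ {u} {v} {r} {q} e hu hv st with portTo (symmetric e)
    ... | p , refl = subst₂ _≤_ (sym (rank-same q)) (sym (rank-same r)) (lowest v hv p was)
      where
      was : home C u ≡ just r
      was with origin u hu
      ... | old h = h
      ... | new {p} hm hp lt acc = contradiction
              (trans (sym (charge-accept (state C r) (demand r) acc)) st) (not-stalled u p hm hp lt)

    potential′ : ∀ v {r} → home C′ v ≡ just r → moves C′ v + rankIn C′ r ≤ 3 * i + 1
    potential′ v {r} eq with fate ok t v
    ... | stays _ g _ = subst₂ (λ x y → moves C v + x + y ≤ 3 * i + 1)
            (sym (cong (maybe _ 0) g)) (sym (rank-same r))
            (subst (λ x → x + rankIn C r ≤ 3 * i + 1) (sym (+-identityʳ (moves C v)))
              (potential v (trans (sym (cong (maybe _ (home C v)) g)) eq)))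
    ... | dies _ _ _ _ _ h = contradiction (trans (sym h) eq) λ ()
    ... | joins {i = r′} tg hp g acc _ h with proposes v tg | just-injective (trans (sym h) eq)
    ...   | m , m′ , hv , hp′ , lt , _ | refl with just-injective (trans (sym hp) hp′)
    ...     | refl = begin
      moves C v + maybe (λ i → bit (admits i)) 0 (goal v) + rankIn C′ r
        ≡⟨ cong₂ (λ x y → moves C v + x + y) (trans (cong (maybe _ 0) g) (cong bit acc)) (rank-same r) ⟩
      moves C v + 1 + rankIn C r   ≡⟨ +-assoc (moves C v) 1 _ ⟩
      moves C v + suc (rankIn C r) ≤⟨ +-monoʳ-≤ (moves C v) lt ⟩
      moves C v + rankIn C m       ≤⟨ potential v hv ⟩
      3 * i + 1                    ∎
      where open ≤-Reasoning

    moves≤′ : ∀ v → moves C′ v ≤ 3 * i + 1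
    moves≤′ v with fate ok t v
    ... | stays _ g _ = subst (λ x → moves C v + x ≤ 3 * i + 1) (sym (cong (maybe _ 0) g))
            (subst (_≤ 3 * i + 1) (sym (+-identityʳ (moves C v))) (moves≤ v))
    ... | joins tg hp g acc _ h = ≤-trans (m≤m+n _ _) (potential′ v h)
    ... | dies tg hp g acc _ h = subst (λ x → moves C v + x ≤ 3 * i + 1)
            (sym (trans (cong (maybe _ 0) g) (cong bit acc)))
            (subst (_≤ 3 * i + 1) (sym (+-identityʳ (moves C v))) (moves≤ v))

    outside′ : ∀ v → lookup S v ≡ false → home C′ v ≡ nothing × moves C′ v ≡ 0
    outside′ v out with goal v in g
    ... | nothing = proj₁ (outside v out) , trans (+-identityʳ _) (proj₂ (outside v out))
    ... | just r  = let _ , _ , h , _ = goal-source v g in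
        contradiction (trans (sym h) (proj₁ (outside v out))) λ ()

    -- Double counting of pairs of a founder and a proposer. Every goal has a founder in `S` by
    -- `founded`, and only one because identifiers are distinct.
    sum-by-goal : ∀ (g : Id → ℕ) →
      sum (λ r → living r * (demand (identifier r) * g (identifier r))) ≡ sum (λ v → maybe g 0 (goal v))
    sum-by-goal g = begin
      sum (λ r → living r * (demand (identifier r) * g (identifier r)))
        ≡⟨ sum-cong-≗ (λ r → expand r) ⟩
      sum (λ r → sum (λ v → H r v))       ≡⟨ ∑-comm H ⟩
      sum (λ v → sum (λ r → H r v))       ≡⟨ sum-cong-≗ (λ v → collapse v (goal v) refl) ⟩
      sum (λ v → maybe g 0 (goal v))      ∎
      where
      open ≡-Reasoning
      H : Fin n → Fin n → ℕ
      H r v = living r * (bit (goal v is identifier r) * g (identifier r))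
      expand : ∀ r → living r * (demand (identifier r) * g (identifier r)) ≡ sum (H r)
      expand r = trans (cong (living r *_) (*-distribʳ-sum (g (identifier r)) (λ v → bit (goal v is identifier r))))
                       (*-distribˡ-sum (living r) (λ v → bit (goal v is identifier r) * g (identifier r)))
      collapse : ∀ v h → goal v ≡ h → sum (λ r → H r v) ≡ maybe g 0 h
      collapse v nothing  eq = sum-zero λ r →
        trans (cong (λ z → living r * (bit z * g (identifier r)))
                (dec-false (≡-decᵐ _≟ⁱ_ (goal v) (just (identifier r))) λ eq′ → contradiction (trans (sym eq) eq′) λ ()))
              (*-zeroʳ (living r))
      collapse v (just m) eq with goal-source v eq
      ... | p , _ , _ , hp , _ with founded (neighbour v p) hp
      ...   | u , Su , refl = trans
        (sum-single (λ r → H r v) u λ r r≢u →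
          trans (cong (λ z → living r * (bit z * g (identifier r)))
                  (dec-false (≡-decᵐ _≟ⁱ_ (goal v) (just (identifier r)))
                    λ eq′ → r≢u (identifier-injective (just-injective (trans (sym eq′) eq)))))
                (*-zeroʳ (living r)))
        (trans (cong₂ (λ x y → bit x * (bit y * g (identifier u))) Su (dec-true (≡-decᵐ _≟ⁱ_ (goal v) (just (identifier u))) eq))
               (trans (+-identityʳ _) (+-identityʳ _)))

    growth′ : ∀ r → level (state C′ r) < b → Growth i (suc j) (state C′ r)
    growth′ r lt = growth-charge (state C r) (demand r) idle (growth r (subst (_< b) (level-same r) lt))

    gain loss : Id → ℕ
    gain r = bit (admits r)
    loss r = 2 * M * bit (not (admits r))

    wealth-balance : wealth C′ + sum (λ v → maybe loss 0 (goal v)) ≡ wealth C + sum (λ v → maybe gain 0 (goal v))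
    wealth-balance = begin
      wealth C′ + sum (λ v → maybe loss 0 (goal v))
        ≡⟨ cong (wealth C′ +_) (sym (sum-by-goal loss)) ⟩
      wealth C′ + sum (λ r → living r * (demand (identifier r) * loss (identifier r)))
        ≡⟨ sym (∑-distrib-+ _ (λ r → living r * (demand (identifier r) * loss (identifier r)))) ⟩
      sum (λ r → living r * tokens (state C′ (identifier r)) + living r * (demand (identifier r) * loss (identifier r)))
        ≡⟨ sum-cong-≗ (λ r → balance (living r) (identifier r)) ⟩
      sum (λ r → living r * tokens (state C (identifier r)) + living r * (demand (identifier r) * gain (identifier r)))
        ≡⟨ ∑-distrib-+ _ (λ r → living r * (demand (identifier r) * gain (identifier r))) ⟩
      wealth C + sum (λ r → living r * (demand (identifier r) * gain (identifier r)))
        ≡⟨ cong (wealth C +_) (sum-by-goal gain) ⟩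
      wealth C + sum (λ v → maybe gain 0 (goal v)) ∎
      where
      open ≡-Reasoning
      balance : ∀ w r → w * tokens (state C′ r) + w * (demand r * loss r) ≡ w * tokens (state C r) + w * (demand r * gain r)
      balance w r = begin
        w * tokens (state C′ r) + w * (demand r * loss r)  ≡⟨ sym (*-distribˡ-+ w _ (demand r * loss r)) ⟩
        w * (tokens (state C′ r) + demand r * loss r)
          ≡⟨ cong (λ z → w * (tokens (state C′ r) + z)) (sym (*-assoc (demand r) (2 * M) (bit (not (admits r))))) ⟩
        w * (tokens (state C′ r) + demand r * (2 * M) * bit (not (admits r)))
          ≡⟨ cong (w *_) (charge-balance (state C r) (demand r)) ⟩
        w * (tokens (state C r) + demand r * gain r)       ≡⟨ *-distribˡ-+ w _ (demand r * gain r) ⟩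
        w * tokens (state C r) + w * (demand r * gain r)   ∎

    lost-step : ∀ v → lost C′ v ≡ lost C v + maybe loss 0 (goal v)
    lost-step v with goal v in g
    ... | nothing = sym (+-identityʳ _)
    ... | just r with goal-source v g
    ...   | p , m , hv , _ with home C v in hv′ | lookup S v in Sv
    ...     | just m′ | false = contradiction (trans (sym hv′) (proj₁ (outside v Sv))) λ ()
    ...     | just m′ | true with admits r
    ...       | true  = sym (*-zeroʳ (2 * M))
    ...       | false = trans (+-identityʳ (2 * M)) (sym (*-identityʳ (2 * M)))

    budget′ : wealth C′ + sum (lost C′) ≤ ∣ S ∣ + sum (moves C′)
    budget′ = begin
      wealth C′ + sum (lost C′)
        ≡⟨ cong (wealth C′ +_) (trans (sum-cong-≗ lost-step) (∑-distrib-+ (lost C) X)) ⟩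
      wealth C′ + (sum (lost C) + sum X)                         ≡⟨ swap (wealth C′) (sum (lost C)) (sum X) ⟩
      wealth C′ + sum X + sum (lost C)                           ≡⟨ cong (_+ sum (lost C)) wealth-balance ⟩
      wealth C + sum Y + sum (lost C)                            ≡⟨ swap′ (wealth C) (sum Y) (sum (lost C)) ⟩
      wealth C + sum (lost C) + sum Y                            ≤⟨ +-monoˡ-≤ (sum Y) budget ⟩
      ∣ S ∣ + sum (moves C) + sum Y                              ≡⟨ +-assoc ∣ S ∣ _ _ ⟩
      ∣ S ∣ + (sum (moves C) + sum Y)                            ≡⟨ cong (∣ S ∣ +_) (sym (∑-distrib-+ (moves C) Y)) ⟩
      ∣ S ∣ + sum (moves C′)                                     ∎
      where
      open ≤-Reasoning
      X Y : Fin n → ℕ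
      X v = maybe loss 0 (goal v)
      Y v = maybe gain 0 (goal v)
      swap : ∀ a b c → a + (b + c) ≡ a + c + b
      swap = solve-∀
      swap′ : ∀ a b c → a + b + c ≡ a + c + b
      swap′ = solve-∀

    invariant : Invariant i (suc j) C′
    invariant = record
      { founded   = founded′
      ; separated = separated′
      ; topmost   = topmost′
      ; level≤b   = λ r → subst (_≤ b) (sym (level-same r)) (level≤b r)
      ; potential = potential′
      ; moves≤    = moves≤′
      ; outside   = outside′
      ; budget    = budget′
      ; growth    = growth′
      }

  module Bump {i : ℕ} {C : Config} (inv : Invariant i K C) where
    open Invariant inv

    level-bump : ∀ r {k} → k < level (bump true (state C r)) →
      k < level (state C r) ⊎ (stalled (state C r) ≡ true × k ≡ level (state C r))
    level-bump r {k} lt with state C r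
    ... | info l _ false = inj₁ lt
    ... | info l _ true with m≤n⇒m<n∨m≡n (s≤s⁻¹ (≤-trans lt (m⊓n≤n b (suc l))))
    ...   | inj₁ k<l = inj₁ k<l
    ...   | inj₂ k≡l = inj₂ (refl , k≡l)

    rank-bump : ∀ r → rank r (level (bump true (state C r))) ≤ 3 + rankIn C r
    rank-bump r = begin
      rank r (level (bump true (state C r)))           ≤⟨ +-mono-≤ (*-monoˡ-≤ 2 (le (state C r))) (bit≤1 _) ⟩
      suc (level (state C r)) * 2 + 1                  ≡⟨ +-comm (suc (level (state C r)) * 2) 1 ⟩
      3 + level (state C r) * 2                        ≤⟨ +-monoʳ-≤ 3 (m≤m+n _ _) ⟩
      3 + rankIn C r                                   ∎
      where
      open ≤-Reasoning
      le : ∀ I → level (bump true I) ≤ suc (level I)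
      le (info l t true)  = m⊓n≤n b (suc l)
      le (info l t false) = n≤1+n l

    separated′ : ∀ {u v r q} → Adj u v → home C u ≡ just r → home C v ≡ just q →
      ∀ k → k < level (bump true (state C r)) → k < level (bump true (state C q)) → bitAt r k ≡ bitAt q k
    separated′ {r = r} {q} e hu hv k k<r k<q with level-bump r k<r | level-bump q k<q
    ... | inj₁ lt | inj₁ lt′ = separated e hu hv k lt lt′
    -- If `k` is new for `r` alone, `q` has a higher level than its stalled neighbour `r`, against
    -- `topmost`.
    ... | inj₂ (st , refl) | inj₁ lt′ =
      contradiction (<-≤-trans lt′ (rank-level {q} {r} (topmost e hu hv st))) (<-irrefl refl)
    ... | inj₁ lt | inj₂ (st , refl) =
      contradiction (<-≤-trans lt (rank-level {r} {q} (topmost (symmetric e) hv hu st))) (<-irrefl refl)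
    -- Both stalled at the same level: `topmost` in both directions makes the ranks equal, hence
    -- also the bits at this level.
    ... | inj₂ (st , refl) | inj₂ (st′ , eq) = rank-bit {r} {q}
      (subst (λ l → rankIn C r ≤ rank q l) (sym eq) (topmost (symmetric e) hv hu st′))
      (subst (λ l → rank q l ≤ rankIn C r) (sym eq) (topmost e hu hv st))

    3-more : 3 + (3 * i + 1) ≡ 3 * suc i + 1
    3-more = regroup i
      where
      regroup : ∀ i → 3 + (3 * i + 1) ≡ 3 * suc i + 1
      regroup = solve-∀

    invariant : Invariant (suc i) 0 (bumped true C)
    invariant = record
      { founded   = founded
      ; separated = separated′
      ; topmost   = λ {_} {_} {r} _ _ _ st → contradiction (trans (sym (calm (state C r))) st) λ ()
      ; level≤b   = λ r → level-bounded (state C r) (level≤b r)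
      ; potential = λ v {r} h → begin
          moves C v + rank r (level (bump true (state C r)))  ≤⟨ +-monoʳ-≤ (moves C v) (rank-bump r) ⟩
          moves C v + (3 + rankIn C r)                        ≡⟨ +-comm-3 (moves C v) (rankIn C r) ⟩
          3 + (moves C v + rankIn C r)                        ≤⟨ +-monoʳ-≤ 3 (potential v h) ⟩
          3 + (3 * i + 1)                                     ≡⟨ 3-more ⟩
          3 * suc i + 1                                       ∎
      ; moves≤    = λ v → ≤-trans (moves≤ v) (subst (3 * i + 1 ≤_) 3-more (m≤n+m (3 * i + 1) 3))
      ; outside   = outside
      ; budget    = subst (λ w → w + sum (lost C) ≤ ∣ S ∣ + sum (moves C))
          (sum-cong-≗ λ r → cong (living r *_) (sym (token-bump (state C (identifier r))))) budget
      ; growth    = λ r lt → growth-bump (state C r) lt (growth r (<-≤-trans′ (state C r) lt))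
      }
      where
      open ≤-Reasoning
      +-comm-3 : ∀ a b → a + (3 + b) ≡ 3 + (a + b)
      +-comm-3 = solve-∀
      calm : ∀ I → stalled (bump true I) ≡ false
      calm (info _ _ _) = refl
      level-bounded : ∀ I → level I ≤ b → level (bump true I) ≤ b
      level-bounded (info l t true)  _  = m⊓n≤m b (suc l)
      level-bounded (info l t false) le = le
      token-bump : ∀ I → tokens (bump true I) ≡ tokens I
      token-bump (info _ _ _) = refl
      <-≤-trans′ : ∀ I → level (bump true I) < b → level I < b
      <-≤-trans′ (info l t false) lt = lt
      <-≤-trans′ (info l t true)  lt with ≤-total b (suc l)
      ... | inj₁ le = contradiction (subst (_< b) (m≤n⇒m⊓n≡m le) lt) (<-irrefl refl)
      ... | inj₂ ge = ge

  -- Steiner trees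

  -- The field `parent` says that a parent is the root or joined at an earlier step. Acyclicity, the
  -- radius bound and the correctness of both sweeps all come from it.
  record Forest (t : ℕ) (C : Config) : Set where
    field
      own     : ∀ v → identifier v ∈ member (trees C v)
      home∈   : ∀ v {i} → home C v ≡ just i → i ∈ member (trees C v)
      origin  : ∀ v {i} → i ∈ member (trees C v) → identifier v ≡ i ⊎ (∃[ s ] ∃[ p ] log (trees C v) s ≡ just (i , p))
      log<    : ∀ v {s e} → log (trees C v) s ≡ just e → s < t
      log∈    : ∀ v {s i p} → log (trees C v) s ≡ just (i , p) → i ∈ member (trees C v)
      parent  : ∀ v {s i p} → log (trees C v) s ≡ just (i , p) → identifier (neighbour v p) ≡ i
                ⊎ (∃[ r ] ∃[ q ] r < s × log (trees C (neighbour v p)) r ≡ just (i , q))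
      unique  : ∀ v {s s′ i p p′} → log (trees C v) s ≡ just (i , p) → log (trees C v) s′ ≡ just (i , p′) → s ≡ s′
      nonroot : ∀ v {s i p} → log (trees C v) s ≡ just (i , p) → identifier v ≢ i
      size    : ∀ v → length (member (trees C v)) ≤ suc (moves C v)

  module Growing {t : ℕ} {C : Config} {tgt : Targets} (ok : Valid C tgt) (forest : Forest t C) where
    open Step C tgt
    open Forest forest

    C′ : Config
    C′ = advance t

    data Joining (v : Fin n) : Set where
      same  : trees C′ v ≡ trees C v → Joining v
      fresh : ∀ {i p} → move v ≡ just (i , p) → i ∉ member (trees C v) →
              trees C′ v ≡ mkTree (i ∷ member (trees C v)) (λ s → if does (s ≟ t) then just (i , p) else log (trees C v) s) →
              Joining v

    joining : ∀ v → Joining v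
    joining v with move v in eq
    ... | nothing = same (cong (λ m → joinTree t m (trees C v)) eq)
    ... | just (i , p) with i ∈? member (trees C v) in eq′
    ...   | yes i∈ = same (trans (cong (λ m → joinTree t m (trees C v)) eq) lemma)
      where
      lemma : joinTree t (just (i , p)) (trees C v) ≡ trees C v
      lemma rewrite eq′ = refl
    ...   | no i∉  = fresh eq i∉ (trans (cong (λ m → joinTree t m (trees C v)) eq) lemma)
      where
      lemma : joinTree t (just (i , p)) (trees C v)
            ≡ mkTree (i ∷ member (trees C v)) (λ s → if does (s ≟ t) then just (i , p) else log (trees C v) s)
      lemma rewrite eq′ = refl

    member-old : ∀ v {i} → i ∈ member (trees C v) → i ∈ member (trees C′ v)
    member-old v i∈ with joining v
    ... | same eq      = subst (λ R → _ ∈ member R) (sym eq) i∈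
    ... | fresh _ _ eq = subst (λ R → _ ∈ member R) (sym eq) (there i∈)

    log-old : ∀ v {s e} → log (trees C v) s ≡ just e → log (trees C′ v) s ≡ just e
    log-old v {s} h with joining v
    ... | same eq      = trans (cong (λ R → log R s) eq) h
    ... | fresh _ _ eq = trans (cong (λ R → log R s) eq)
            (trans (if-no (s ≟ t) (λ s≡t → <-irrefl s≡t (log< v h))) h)

    data Entry (v : Fin n) (s : ℕ) (i : Id) (p : Fin (degree v)) : Set where
      old : log (trees C v) s ≡ just (i , p) → Entry v s i p
      new : s ≡ t → move v ≡ just (i , p) → i ∉ member (trees C v) → i ∈ member (trees C′ v) → Entry v s i p

    entry : ∀ v {s i p} → log (trees C′ v) s ≡ just (i , p) → Entry v s i p
    entry v {s} h with joining v
    ... | same eq = old (trans (sym (cong (λ R → log R s) eq)) h)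
    ... | fresh {j} m j∉ eq with s ≟ t
    ...   | no s≢t = old (trans (sym (trans (cong (λ R → log R s) eq) (if-no (s ≟ t) s≢t))) h)
    ...   | yes s≡t with trans (sym (trans (cong (λ R → log R s) eq) (if-yes (s ≟ t) s≡t))) h
    ...     | refl = new s≡t m j∉ (subst (λ R → j ∈ member R) (sym eq) (here refl))

    move-source : ∀ v {i p} → move v ≡ just (i , p) → home C (neighbour v p) ≡ just i × home C′ v ≡ just i
      × moves C′ v ≡ suc (moves C v)
    move-source v eq with fate ok t v
    ... | stays _ _ m        = contradiction (trans (sym m) eq) λ ()
    ... | dies _ _ _ _ m _   = contradiction (trans (sym m) eq) λ ()
    ... | joins _ hp g acc m h with trans (sym m) eq
    ...   | refl = hp , h , trans (cong (moves C v +_) (trans (cong (maybe _ 0) g) (cong bit acc))) (+-comm (moves C v) 1)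

    home-member : ∀ v {i} → home C′ v ≡ just i → i ∈ member (trees C′ v)
    home-member v eq with fate ok t v
    ... | stays _ g _ = member-old v (home∈ v (trans (sym (cong (maybe _ (home C v)) g)) eq))
    ... | dies _ _ _ _ _ h = contradiction (trans (sym h) eq) λ ()
    ... | joins {p} {i} _ _ _ _ m h with trans (sym h) eq
    ...   | refl with i ∈? member (trees C v)
    ...     | yes i∈ = member-old v i∈
    ...     | no i∉ with joining v
    ...       | fresh {j} m′ _ eq′ with trans (sym m) m′
    ...         | refl = subst (λ R → j ∈ member R) (sym eq′) (here refl)
    home-member v eq | joins {p} {i} _ _ _ _ m h | refl | no i∉ | same eq′ =
      contradiction (trans (cong (λ x → length (member (joinTree t x (trees C v)))) (sym m)) (cong (λ R → length (member R)) eq′))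
                    lemma
      where
      lemma : length (member (joinTree t (just (i , p)) (trees C v))) ≢ length (member (trees C v))
      lemma e with i ∈? member (trees C v)
      ... | yes i∈ = i∉ i∈
      ... | no _   = 1+n≢n e

    grown : Forest (suc t) C′
    grown = record
      { own     = λ v → member-old v (own v)
      ; home∈   = home-member
      ; origin  = origin′
      ; log<    = log<′
      ; log∈    = log∈′
      ; parent  = parent′
      ; unique  = unique′
      ; nonroot = nonroot′
      ; size    = size′
      }
      where
      before : ∀ v {i} → i ∈ member (trees C v) → identifier v ≡ i ⊎ (∃[ s ] ∃[ p ] log (trees C′ v) s ≡ just (i , p))
      before v i∈ with origin v i∈
      ... | inj₁ eq          = inj₁ eq
      ... | inj₂ (s , p , h) = inj₂ (s , p , log-old v h)
      origin′ : ∀ v {i} → i ∈ member (trees C′ v) → identifier v ≡ i ⊎ (∃[ s ] ∃[ p ] log (trees C′ v) s ≡ just (i , p))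
      origin′ v {i} i∈ with joining v
      ... | same eq = before v (subst (λ R → i ∈ member R) eq i∈)
      ... | fresh {j} {p} _ _ eq with subst (λ R → i ∈ member R) eq i∈
      ...   | there i∈′ = before v i∈′
      ...   | here refl = inj₂ (t , p , trans (cong (λ R → log R t) eq) (if-yes (t ≟ t) refl))
      log<′ : ∀ v {s e} → log (trees C′ v) s ≡ just e → s < suc t
      log<′ v h with entry v h
      ... | old h′       = m<n⇒m<1+n (log< v h′)
      ... | new refl _ _ _ = ≤-refl
      log∈′ : ∀ v {s i p} → log (trees C′ v) s ≡ just (i , p) → i ∈ member (trees C′ v)
      log∈′ v h with entry v h
      ... | old h′       = member-old v (log∈ v h′)
      ... | new _ _ _ i∈ = i∈
      parent′ : ∀ v {s i p} → log (trees C′ v) s ≡ just (i , p) → identifier (neighbour v p) ≡ i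
                ⊎ (∃[ r ] ∃[ q ] r < s × log (trees C′ (neighbour v p)) r ≡ just (i , q))
      parent′ v {s} {i} {p} h with entry v h
      ... | old h′ with parent v h′
      ...   | inj₁ eq                = inj₁ eq
      ...   | inj₂ (r , q , r<s , l) = inj₂ (r , q , r<s , log-old (neighbour v p) l)
      parent′ v {s} {i} {p} h | new refl m _ _ with origin (neighbour v p) (home∈ (neighbour v p) (proj₁ (move-source v m)))
      ...   | inj₁ eq          = inj₁ eq
      ...   | inj₂ (r , q , l) = inj₂ (r , q , log< (neighbour v p) l , log-old (neighbour v p) l)
      unique′ : ∀ v {s s′ i p p′} → log (trees C′ v) s ≡ just (i , p) → log (trees C′ v) s′ ≡ just (i , p′) → s ≡ s′
      unique′ v h h′ with entry v h | entry v h′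
      ... | old l          | old l′          = unique v l l′
      ... | new refl _ _ _ | new refl _ _ _  = refl
      ... | old l          | new _ _ i∉ _    = contradiction (log∈ v l) i∉
      ... | new _ _ i∉ _   | old l           = contradiction (log∈ v l) i∉
      nonroot′ : ∀ v {s i p} → log (trees C′ v) s ≡ just (i , p) → identifier v ≢ i
      nonroot′ v h refl with entry v h
      ... | old l        = nonroot v l refl
      ... | new _ _ i∉ _ = i∉ (own v)
      size′ : ∀ v → length (member (trees C′ v)) ≤ suc (moves C′ v)
      size′ v with joining v
      ... | same eq = subst (λ R → length (member R) ≤ suc (moves C′ v)) (sym eq) (≤-trans (size v) (s≤s (m≤m+n _ _)))
      ... | fresh m _ eq = subst₂ (λ R k → length (member R) ≤ suc k) (sym eq) (sym (proj₂ (proj₂ (move-source v m))))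
              (s≤s (size v))

  -- Simulating one step

  n<2^1+b : ∀ {k} → k ≤ n → k < 2 ^ suc b
  n<2^1+b {k} k≤n = begin-strict
    k            ≤⟨ ≤-trans k≤n (injective⇒≤2^ identifier-injective) ⟩
    2 ^ b        <⟨ m<m+n (2 ^ b) (m^n>0 2 b) ⟩
    2 ^ b + 2 ^ b ≡⟨ cong (2 ^ b +_) (sym (+-identityʳ _)) ⟩
    2 ^ suc b    ∎
    where open ≤-Reasoning

  level-exact : ∀ {l} → l ≤ b → fromBits (toBits (suc b) l) ≡ l
  level-exact {l} l≤b = fromBits-toBits (suc b) (≤-<-trans (≤-trans l≤b (n≤1+n b)) (b<2^b (suc b)))

  -- Covers what must be right between steps; the working fields are described within a step by
  -- `Asked`, `Flow` and `Downcast`.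
  record Matches (C : Config) (X : Nodes) : Set where
    field
      self≡    : ∀ v → self (X v) ≡ identifier v
      cluster≡ : ∀ v → cluster (X v) ≡ Maybe.map (λ i → i , level (state C i)) (home C v)
      root≡    : ∀ v → root (X v) ≡ state C (identifier v)
      tree≡    : ∀ v → tree (X v) ≡ trees C v

    clusterId≡ : ∀ v → clusterId (X v) ≡ home C v
    clusterId≡ v = trans (cong (Maybe.map proj₁) (cluster≡ v)) (lemma (home C v))
      where
      lemma : ∀ h → Maybe.map proj₁ (Maybe.map (λ i → i , level (state C i)) h) ≡ h
      lemma nothing  = refl
      lemma (just _) = refl

  -- Ports are determined by neighbours, so the far end of the edge is the port `p` again. With `v`
  -- a variable, `refl` can identify it with `neighbour u q`, and no port is transported.
  upward-back : ∀ (R : ∀ v → Tree Id (degree v)) {u v} s p (q : Fin (degree u)) → neighbour v p ≡ u → neighbour u q ≡ v →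
    upward (R (neighbour u q)) s (back u q) ≡ upward (R v) s p
  upward-back R {u} s p q eq refl =
    cong (upward (R (neighbour u q)) s) (neighbour-injective (neighbour u q) (trans (neighbour-back u q) (sym eq)))

  upward-just : ∀ {d} (R : Tree Id d) s {p i} → log R s ≡ just (i , p) → upward R s p ≡ just i
  upward-just R s {p} {i} h = trans (cong (_>>= λ (j , q) → if does (q ≟ᶠ p) then just j else nothing) h)
    (if-yes (p ≟ᶠ p) refl)

  upward-log : ∀ {d} (R : Tree Id d) s {p i} → upward R s p ≡ just i → log R s ≡ just (i , p)
  upward-log R s {p} eq with log R s
  ... | just (j , q) with q ≟ᶠ p
  upward-log R s refl | just (j , q) | yes refl = refl

  module Announce {C X Y} (matches : Matches C X) (level≤b : ∀ r → level (state C r) ≤ b) (round : Round announce X Y) where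
    open Matches matches
    open Round round

    targets : Targets
    targets v = target (Y v)

    heard : ∀ k v q → heardRank k (inbox v q) ≡ maybe (rankIn C) k (home C (neighbour v q))
    heard k v q = trans (cong (heardRank k) (received v q))
      (trans (cong (λ c → heardRank k (maybe (λ (i , l) → packet true i (toBits (suc b) l)) blank c)) (cluster≡ (neighbour v q)))
        (lemma (home C (neighbour v q))))
      where
      lemma : ∀ h → heardRank k (maybe (λ (i , l) → packet true i (toBits (suc b) l)) blank
        (Maybe.map (λ i → i , level (state C i)) h)) ≡ maybe (rankIn C) k h
      lemma nothing  = refl
      lemma (just i) = cong (rank i) (level-exact (level≤b i))

    target≡ : ∀ v → targets v ≡ (home C v >>= λ j → choose (inbox v) (j , level (state C j)))
    target≡ v = trans (cong target (becomes v)) (trans (cong (_>>= choose (inbox v)) (cluster≡ v)) (lemma (home C v)))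
      where
      lemma : ∀ h → (Maybe.map (λ i → i , level (state C i)) h >>= choose (inbox v))
                  ≡ (h >>= λ j → choose (inbox v) (j , level (state C j)))
      lemma nothing  = refl
      lemma (just _) = refl

    valid : Valid C targets
    valid = record { proposes = proposes ; content = content }
      where
      proposes : ∀ v {p} → targets v ≡ just p → ∃[ j ] ∃[ i ] home C v ≡ just j × home C (neighbour v p) ≡ just i
                 × rankIn C i < rankIn C j × (∀ q {r} → home C (neighbour v q) ≡ just r → rankIn C i ≤ rankIn C r)
      proposes v {p} eq with home C v | trans (sym (target≡ v)) eq
      ... | just j | eq′ with smallestBelow-just _ _ eq′
      ...   | lt , least with home C (neighbour v p) in hp | subst (_< rankIn C j) (heard _ v p) lt
      ...     | nothing | lt′ = contradiction lt′ (<-irrefl refl)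
      ...     | just i  | lt′ = j , i , refl , refl , lt′ , λ q {r} hq →
        subst₂ _≤_ (trans (heard _ v p) (cong (maybe (rankIn C) _) hp)) (trans (heard _ v q) (cong (maybe (rankIn C) _) hq)) (least q)
      content : ∀ v {j} → targets v ≡ nothing → home C v ≡ just j →
                ∀ q {r} → home C (neighbour v q) ≡ just r → rankIn C j ≤ rankIn C r
      content v {j} eq hv q hq = subst (rankIn C j ≤_) (trans (heard _ v q) (cong (maybe (rankIn C) _) hq))
        (smallestBelow-nothing _ _ (trans (cong (_>>= λ j → choose (inbox v) (j , level (state C j))) (sym hv))
          (trans (sym (target≡ v)) eq)) q)

    matches′ : Matches C Y
    matches′ = record
      { self≡    = λ v → trans (cong self (becomes v)) (self≡ v)
      ; cluster≡ = λ v → trans (cong cluster (becomes v)) (cluster≡ v)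
      ; root≡    = λ v → trans (cong root (becomes v)) (root≡ v)
      ; tree≡    = λ v → trans (cong tree (becomes v)) (tree≡ v)
      }

  module Propose {C X Y} (matches : Matches C X) (round : Round propose X Y) where
    open Matches matches
    open Round round
    open Step C (λ v → target (X v))

    target-same : ∀ v → target (Y v) ≡ target (X v)
    target-same v = cong target (becomes v)

    matches′ : Matches C Y
    matches′ = record
      { self≡    = λ v → trans (cong self (becomes v)) (self≡ v)
      ; cluster≡ = λ v → trans (cong cluster (becomes v)) (cluster≡ v)
      ; root≡    = λ v → trans (cong root (becomes v)) (root≡ v)
      ; tree≡    = λ v → trans (cong tree (becomes v)) (tree≡ v)
      }

    chosen : ∀ v → Fin (degree v) → Bool
    chosen v p = does (≡-decᵐ _≟ᶠ_ (target (X v)) (just p))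

    acc≡ : ∀ v i → acc (Y v) i ≡ (if home C v is i then sum (λ p → bit (chosen (neighbour v p) (back v p))) else 0)
    acc≡ v i = trans (cong (λ x → acc x i) (becomes v))
      (cong₂ (λ h k → if h is i then k else 0) (clusterId≡ v) (sum-cong-≗ λ p → cong (λ m → bit (flag m)) (received v p)))

    support : ∀ v i → acc (Y v) i ≢ 0 → home C v ≡ just i
    support v i ≢0 with ≡-decᵐ _≟ⁱ_ (home C v) (just i) | acc≡ v i
    ... | yes eq | _  = eq
    ... | no _   | eq = contradiction eq ≢0

    -- A proposer marks one port, and behind it sits a member of its goal. Counting marks at the
    -- members of `i` therefore counts each proposer to `i` once.
    total : ∀ i → sum (λ v → acc (Y v) i) ≡ demand i
    total i = begin
      sum (λ v → acc (Y v) i)                                         ≡⟨ sum-cong-≗ distribute ⟩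
      sum (λ v → sum (λ p → aimed (neighbour v p) (back v p)))        ≡⟨ sum-halfEdges aimed ⟩
      sum (λ u → sum (aimed u))                                       ≡⟨ sum-cong-≗ collapse ⟩
      demand i                                                        ∎
      where
      open ≡-Reasoning
      aimed : ∀ u → Fin (degree u) → ℕ
      aimed u q = if chosen u q then bit (home C (neighbour u q) is i) else 0
      if-* : ∀ {d} (f : Fin d → Bool) x → (if x then sum (λ p → bit (f p)) else 0) ≡ sum (λ p → if f p then bit x else 0)
      if-* f true  = refl
      if-* f false = sym (sum-zero λ p → lemma (f p))
        where
        lemma : ∀ x → (if x then 0 else 0) ≡ 0
        lemma true  = refl
        lemma false = refl
      distribute : ∀ v → acc (Y v) i ≡ sum (λ p → aimed (neighbour v p) (back v p))
      distribute v = trans (acc≡ v i) (trans (if-* (λ p → chosen (neighbour v p) (back v p)) (home C v is i))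
        (sum-cong-≗ λ p → cong (λ u → if chosen (neighbour v p) (back v p) then bit (home C u is i) else 0) (sym (neighbour-back v p))))
      collapse : ∀ u → sum (aimed u) ≡ bit (goal u is i)
      collapse u with target (X u)
      ... | nothing = sum-zero {degree u} λ q → refl
      ... | just p  = trans (sum-single _ p λ q q≢p → if-no (≡-decᵐ _≟ᶠ_ (just p) (just q)) (λ eq → q≢p (sym (just-injective eq))))
                            (if-yes (≡-decᵐ _≟ᶠ_ (just p) (just p)) refl)

  -- In slot s exactly the nodes that joined a tree at step s talk to their
  -- parents, and a node joins at most one tree per step: no edge is congested.
  record Asked (C : Config) (tgt : Targets) (t s : ℕ) (X : Nodes) : Set where
    field
      matches : Matches C X
      target≡ : ∀ v → target (X v) ≡ tgt v
      asked≡  : ∀ r → s ≤ r → r < t → ∀ v p → asked (X v) r p ≡ upward (trees C (neighbour v p)) r (back v p)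

  -- Counts for `i` survive only at the root of `i` and at nodes that joined before step `s`, so at
  -- `s = 0` the root holds the whole sum. `bounded` makes the partial sums fit into a message.
  record Flow (C : Config) (d : Id → ℕ) (s : ℕ) (X : Nodes) : Set where
    field
      total   : ∀ i → sum (λ v → acc (X v) i) ≡ d i
      bounded : ∀ i → d i ≤ n
      support : ∀ v i → acc (X v) i ≢ 0 → identifier v ≡ i ⊎ (∃[ r ] ∃[ p ] r < s × log (trees C v) r ≡ just (i , p))

  module Up {C tgt t s X Y} (asked : Asked C tgt t (suc s) X) (round : Round (up s) X Y) where
    open Asked asked
    open Matches matches
    open Round round

    climbing : ∀ v → Fin (degree v) → Maybe Id
    climbing v p = upward (trees C v) s p

    inbox≡ : ∀ v p → inbox v p ≡
      maybe (λ i → packet true i (toBits (suc b) (acc (X (neighbour v p)) i))) blank (climbing (neighbour v p) (back v p))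
    inbox≡ v p = trans (received v p) (cong (λ R → maybe (λ i → packet true i _) blank (upward R s (back v p))) (tree≡ (neighbour v p)))

    asked′ : Asked C tgt t s Y
    asked′ = record
      { matches = record
        { self≡    = λ v → trans (cong self (becomes v)) (self≡ v)
        ; cluster≡ = λ v → trans (cong cluster (becomes v)) (cluster≡ v)
        ; root≡    = λ v → trans (cong root (becomes v)) (root≡ v)
        ; tree≡    = λ v → trans (cong tree (becomes v)) (tree≡ v)
        }
      ; target≡ = λ v → trans (cong target (becomes v)) (target≡ v)
      ; asked≡  = λ r s≤r r<t v p → trans (cong (λ x → Node.asked x r p) (becomes v)) (record-asked r s≤r r<t v p)
      }
      where
      ident-of : ∀ {f : Id → Vec Bool (suc b)} (u : Maybe Id) →
        (if flag (maybe (λ i → packet true i (f i)) blank u) then just (ident (maybe (λ i → packet true i (f i)) blank u)) else nothing) ≡ u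
      ident-of nothing  = refl
      ident-of (just _) = refl
      record-asked : ∀ r → s ≤ r → r < t → ∀ v p →
        (if does (r ≟ s) then (if flag (inbox v p) then just (ident (inbox v p)) else nothing) else Node.asked (X v) r p)
        ≡ upward (trees C (neighbour v p)) r (back v p)
      record-asked r s≤r r<t v p with r ≟ s
      ... | yes refl = trans (if-yes (r ≟ r) refl)
              (trans (cong (λ m → if flag m then just (ident m) else nothing) (inbox≡ v p)) (ident-of (climbing (neighbour v p) (back v p))))
      ... | no r≢s   = trans (if-no (r ≟ s) r≢s) (asked≡ r (≤∧≢⇒< s≤r (λ eq → r≢s (sym eq))) r<t v p)

    module _ {d : Id → ℕ} (forest : Forest t C) (flow : Flow C d (suc s) X) where
      open Flow flow
      open Forest forest

      acc≤n : ∀ v i → acc (X v) i ≤ n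
      acc≤n v i = ≤-trans (term≤sum (λ u → acc (X u) i) v) (≤-trans (≤-reflexive (total i)) (bounded i))

      carried : ∀ i v → Fin (degree v) → ℕ
      carried i v p = if climbing v p is i then acc (X v) i else 0

      kept : ∀ i v → ℕ
      kept i v = if joined (trees C v) s is i then 0 else acc (X v) i

      arriving : ∀ i v p → (if flag (inbox v p) ∧ does (ident (inbox v p) ≟ⁱ i) then fromBits (number (inbox v p)) else 0)
        ≡ carried i (neighbour v p) (back v p)
      arriving i v p = trans (cong (λ m → if flag m ∧ does (ident m ≟ⁱ i) then fromBits (number m) else 0) (inbox≡ v p))
        (lemma (climbing (neighbour v p) (back v p)))
        where
        u = neighbour v p
        message : Maybe Id → Packet
        message = maybe (λ j → packet true j (toBits (suc b) (acc (X u) j))) blank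
        lemma : ∀ c → (if flag (message c) ∧ does (ident (message c) ≟ⁱ i) then fromBits (number (message c)) else 0)
                      ≡ (if c is i then acc (X u) i else 0)
        lemma nothing = refl
        lemma (just j) with j ≟ⁱ i
        ... | yes refl = fromBits-toBits (suc b) (n<2^1+b (acc≤n u j))
        ... | no _     = refl

      acc≡ : ∀ i v → acc (Y v) i ≡ kept i v + sum (λ p → carried i (neighbour v p) (back v p))
      acc≡ i v = trans (cong (λ x → acc x i) (becomes v))
        (cong₂ _+_ (cong (λ R → if joined R s is i then 0 else acc (X v) i) (tree≡ v)) (sum-cong-≗ (arriving i v)))

      -- A node that joined `i` at step `s` sends its whole count through its one parent port, and
      -- any other node keeps it.
      conserved : ∀ i v → kept i v + sum (carried i v) ≡ acc (X v) i
      conserved i v = cases (≡-decᵐ _≟ⁱ_ (joined (trees C v) s) (just i))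
        where
        lemma : ∀ l → log (trees C v) s ≡ l → Maybe.map proj₁ l ≡ just i → kept i v + sum (carried i v) ≡ acc (X v) i
        lemma (just (.i , p)) h refl = cong₂ _+_
          (if-yes (≡-decᵐ _≟ⁱ_ (joined (trees C v) s) (just i)) (cong (Maybe.map proj₁) h))
          (trans (sum-single (carried i v) p λ q q≢p → if-no (≡-decᵐ _≟ⁱ_ (climbing v q) (just i))
                   (λ c → q≢p (cong proj₂ (just-injective (trans (sym (upward-log (trees C v) s c)) h)))))
                 (if-yes (≡-decᵐ _≟ⁱ_ (climbing v p) (just i)) (upward-just (trees C v) s h)))
        cases : Dec (joined (trees C v) s ≡ just i) → kept i v + sum (carried i v) ≡ acc (X v) i
        cases (yes eq) = lemma (log (trees C v) s) refl eq
        cases (no ne)  = trans (cong₂ _+_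
          (if-no (≡-decᵐ _≟ⁱ_ (joined (trees C v) s) (just i)) ne)
          (sum-zero λ q → if-no (≡-decᵐ _≟ⁱ_ (climbing v q) (just i))
            (λ c → ne (cong (Maybe.map proj₁) (upward-log (trees C v) s c)))))
          (+-identityʳ _)

      total′ : ∀ i → sum (λ v → acc (Y v) i) ≡ d i
      total′ i = begin
        sum (λ v → acc (Y v) i)                                                  ≡⟨ sum-cong-≗ (acc≡ i) ⟩
        sum (λ v → kept i v + sum (λ p → carried i (neighbour v p) (back v p)))
          ≡⟨ ∑-distrib-+ (kept i) (λ v → sum (λ p → carried i (neighbour v p) (back v p))) ⟩
        sum (kept i) + sum (λ v → sum (λ p → carried i (neighbour v p) (back v p)))
          ≡⟨ cong (sum (kept i) +_) (sum-halfEdges (carried i)) ⟩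
        sum (kept i) + sum (λ v → sum (carried i v))                             ≡⟨ sym (∑-distrib-+ (kept i) (λ v → sum (carried i v))) ⟩
        sum (λ v → kept i v + sum (carried i v))                                 ≡⟨ sum-cong-≗ (conserved i) ⟩
        sum (λ v → acc (X v) i)                                                  ≡⟨ total i ⟩
        d i                                                                      ∎
        where open ≡-Reasoning

      -- A count that was kept belongs to a node that did not join at step `s`; one that was
      -- received came from a child of step `s`, whose parent joined earlier or is the root.
      support′ : ∀ v i → acc (Y v) i ≢ 0 → identifier v ≡ i ⊎ (∃[ r ] ∃[ p ] r < s × log (trees C v) r ≡ just (i , p))
      support′ v i ≢0 with kept i v in k | acc≡ i v
      ... | suc _ | _ = still (≡-decᵐ _≟ⁱ_ (joined (trees C v) s) (just i))
        where
        still : Dec (joined (trees C v) s ≡ just i) →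
                identifier v ≡ i ⊎ (∃[ r ] ∃[ p ] r < s × log (trees C v) r ≡ just (i , p))
        still (yes eq) = contradiction (trans (sym k) (if-yes (≡-decᵐ _≟ⁱ_ (joined (trees C v) s) (just i)) eq)) λ ()
        still (no ne) with support v i (λ eq → 1+n≢0 (trans (sym k) (trans (if-no (≡-decᵐ _≟ⁱ_ (joined (trees C v) s) (just i)) ne) eq)))
        ... | inj₁ eq = inj₁ eq
        ... | inj₂ (r , p , r<s , h) = inj₂ (r , p , ≤∧≢⇒< (s≤s⁻¹ r<s) (λ { refl → ne (cong (Maybe.map proj₁) h) }) , h)
      ... | zero | eq with sum-positive _ (λ z → ≢0 (trans eq z))
      ...   | p , ne = moved (≡-decᵐ _≟ⁱ_ (climbing (neighbour v p) (back v p)) (just i))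
        where
        transport : ∀ {u w} → u ≡ w → (∃[ r ] ∃[ q ] r < s × log (trees C u) r ≡ just (i , q)) →
                    ∃[ r ] ∃[ q ] r < s × log (trees C w) r ≡ just (i , q)
        transport refl x = x
        moved : Dec (climbing (neighbour v p) (back v p) ≡ just i) →
                identifier v ≡ i ⊎ (∃[ r ] ∃[ p ] r < s × log (trees C v) r ≡ just (i , p))
        moved (no c≢) = contradiction (if-no (≡-decᵐ _≟ⁱ_ (climbing (neighbour v p) (back v p)) (just i)) c≢) ne
        moved (yes c≡) with parent (neighbour v p) (upward-log (trees C (neighbour v p)) s c≡)
        ... | inj₁ id≡ = inj₁ (trans (cong identifier (sym (neighbour-back v p))) id≡)
        ... | inj₂ above = inj₂ (transport (neighbour-back v p) above)

      flow′ : Flow C d s Y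
      flow′ = record { total = total′ ; bounded = bounded ; support = support′ }

  ups-asked : ∀ {C tgt t} s {X Y} → Asked C tgt t s X → Rounds (ups s) X Y → Asked C tgt t 0 Y
  ups-asked zero    a []       = a
  ups-asked (suc s) a (r ∷ rs) = ups-asked s (Up.asked′ a r) rs

  ups-flow : ∀ {C tgt t d} s {X Y} → Forest t C → Asked C tgt t s X → Flow C d s X → Rounds (ups s) X Y → Flow C d 0 Y
  ups-flow zero    _ _ f []       = f
  ups-flow (suc s) F a f (r ∷ rs) = ups-flow s F (Up.asked′ a r) (Up.flow′ a r F f) rs

  level-settle : ∀ e I x → level I ≤ b → level (settle e I x) ≤ b
  level-settle e I x le with charge I x | level-charge I x
  level-settle false I x le | info l t s     | refl = le
  level-settle true  I x le | info l t false | refl = le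
  level-settle true  I x le | info l t true  | refl = m⊓n≤m b (suc l)

  module _ {C : Config} {tgt : Targets} (t : ℕ) (e : Bool) (level≤b : ∀ r → level (state C r) ≤ b)
           (ok : Valid C tgt) (forest : Forest t C) where
    open Step C tgt
    open Forest forest

    C″ : Config
    C″ = next t e C tgt

    rules : Id → Bool × ℕ
    rules i = admits i , level (state C″ i)

    -- The bound of `Flow.support` with the direction reversed: here it describes who has learnt the
    -- verdict on `i` before slot `s`.
    Reached : ℕ → Fin n → Id → Set
    Reached s v i = identifier v ≡ i ⊎ (∃[ r ] ∃[ p ] r < s × log (trees C v) r ≡ just (i , p))

    member-reached : ∀ v {i} → i ∈ member (trees C v) → Reached t v i
    member-reached v i∈ with origin v i∈
    ... | inj₁ eq          = inj₁ eq
    ... | inj₂ (r , p , h) = inj₂ (r , p , log< v h , h)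

    -- Roots are already in the state of `C″`, while homes and trees are still those of `C`. Of
    -- `cluster` only the identifier is tracked, as its level may be outdated until `resolve`.
    record Downcast (s : ℕ) (X : Nodes) : Set where
      field
        self≡      : ∀ v → self (X v) ≡ identifier v
        clusterId≡ : ∀ v → clusterId (X v) ≡ home C v
        root≡      : ∀ v → root (X v) ≡ state C″ (identifier v)
        tree≡      : ∀ v → tree (X v) ≡ trees C v
        target≡    : ∀ v → target (X v) ≡ tgt v
        asked≡     : ∀ r → r < t → ∀ v p → asked (X v) r p ≡ upward (trees C (neighbour v p)) r (back v p)
        verdict≡   : ∀ v i → Reached s v i → verdict (X v) i ≡ rules i

    decided : ∀ {X Y} → Asked C tgt t 0 X → Flow C demand 0 X → Round (decide e) X Y → Downcast 0 Y
    decided {X} {Y} a flow round = record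
      { self≡      = λ v → trans (cong self (becomes v)) (self≡ v)
      ; clusterId≡ = λ v → trans (cong clusterId (becomes v)) (clusterId≡ v)
      ; root≡      = λ v → trans (cong root (becomes v)) (cong₂ (settle e) (root≡ v) (acc-root v))
      ; tree≡      = λ v → trans (cong tree (becomes v)) (tree≡ v)
      ; target≡    = λ v → trans (cong target (becomes v)) (target≡ v)
      ; asked≡     = λ r r<t v p → trans (cong (λ x → asked x r p) (becomes v)) (asked≡ r z≤n r<t v p)
      ; verdict≡   = λ { v i (inj₁ refl) → trans (cong (λ x → verdict x i) (becomes v))
                           (cong₂ (λ I x → accepts I x , level (settle e I x)) (root≡ v) (acc-root v))
                       ; v i (inj₂ (_ , _ , () , _)) }
      }
      where
      open Asked a
      open Matches matches
      open Flow flow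
      open Round round
      acc-root : ∀ v → acc (X v) (self (X v)) ≡ demand (identifier v)
      acc-root v = trans (cong (acc (X v)) (self≡ v))
        (trans (sym (sum-single (λ u → acc (X u) (identifier v)) v others)) (total (identifier v)))
        where
        others : ∀ u → u ≢ v → acc (X u) (identifier v) ≡ 0
        others u u≢v with acc (X u) (identifier v) in eq
        ... | zero  = refl
        ... | suc _ with support u (identifier v) (λ z → 1+n≢0 (trans (sym eq) z))
        ...   | inj₁ id≡ = contradiction (identifier-injective id≡) u≢v

    ruled : ∀ {X : Nodes} {v i} → verdict (X v) i ≡ rules i →
      flag (ruling (X v) i) ≡ admits i × fromBits (number (ruling (X v) i)) ≡ level (state C″ i)
    ruled {X} {v} {i} eq = cong proj₁ eq ,
      trans (cong (λ z → fromBits (toBits (suc b) (proj₂ z))) eq) (level-exact (level-settle e (state C i) (demand i) (level≤b i)))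

    -- The parent joined before step `s` or is the root, so it knows the verdict; it answers for the
    -- right tree on the right port because `asked` holds the child's own claim from slot `s`.
    downward : ∀ {s X Y} → s < t → Downcast s X → Round (down s) X Y → Downcast (suc s) Y
    downward {s} {X} {Y} s<t d round = record
      { self≡      = λ v → trans (frame v self λ { nothing → refl ; (just _) → refl }) (self≡ v)
      ; clusterId≡ = λ v → trans (frame v clusterId λ { nothing → refl ; (just _) → refl }) (clusterId≡ v)
      ; root≡      = λ v → trans (frame v root λ { nothing → refl ; (just _) → refl }) (root≡ v)
      ; tree≡      = λ v → trans (frame v tree λ { nothing → refl ; (just _) → refl }) (tree≡ v)
      ; target≡    = λ v → trans (frame v target λ { nothing → refl ; (just _) → refl }) (target≡ v)
      ; asked≡     = λ r r<t v p → trans (frame v (λ x → asked x r p) λ { nothing → refl ; (just _) → refl }) (asked≡ r r<t v p)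
      ; verdict≡   = verdict′
      }
      where
      open Downcast d
      open Round round
      after : ∀ v → Maybe (Id × Fin (degree v)) → Node (degree v)
      after v nothing        = X v
      after v (just (i , p)) = record (X v)
        { verdict = λ j → if does (j ≟ⁱ i) then (flag (inbox v p) , fromBits (number (inbox v p))) else verdict (X v) j }
      becomes′ : ∀ v → Y v ≡ after v (log (trees C v) s)
      becomes′ v = trans (becomes v) (trans (lemma v) (cong (λ R → after v (log R s)) (tree≡ v)))
        where
        lemma : ∀ v → recvN (down s) (X v) (inbox v) ≡ after v (log (tree (X v)) s)
        lemma v with log (tree (X v)) s
        ... | nothing      = refl
        ... | just (_ , _) = refl
      frame : ∀ {A : Set} v (f : Node (degree v) → A) → (∀ l → f (after v l) ≡ f (X v)) → f (Y v) ≡ f (X v)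
      frame v f unaffected = trans (cong f (becomes′ v)) (unaffected (log (trees C v) s))
      answer : ∀ v {i p} → log (trees C v) s ≡ just (i , p) →
        (flag (inbox v p) , fromBits (number (inbox v p))) ≡ rules i
      answer v {i} {p} h = trans (cong (λ m → flag m , fromBits (number m)) message)
        (cong₂ _,_ (proj₁ (ruled {X} knows)) (proj₂ (ruled {X} knows)))
        where
        u = neighbour v p
        knows : verdict (X u) i ≡ rules i
        knows = verdict≡ u i (parent v h)
        message : inbox v p ≡ ruling (X u) i
        message = trans (received v p) (cong (maybe (ruling (X u)) blank)
          (trans (asked≡ s s<t u (back v p))
            (trans (upward-back (trees C) s p (back v p) refl (neighbour-back v p)) (upward-just (trees C v) s h))))
      verdict′ : ∀ v i → Reached (suc s) v i → verdict (Y v) i ≡ rules i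
      verdict′ v i reached = trans (cong (λ x → verdict x i) (becomes′ v)) (lemma (log (trees C v) s) refl)
        where
        before : ∀ l → log (trees C v) s ≡ l → (∀ p → l ≢ just (i , p)) → Reached (suc s) v i → Reached s v i
        before l h ne (inj₁ eq) = inj₁ eq
        before l h ne (inj₂ (r , p , r< , h′)) =
          inj₂ (r , p , ≤∧≢⇒< (s≤s⁻¹ r<) (λ { refl → ne p (trans (sym h) h′) }) , h′)
        lemma : ∀ l → log (trees C v) s ≡ l → verdict (after v l) i ≡ rules i
        lemma nothing h = verdict≡ v i (before nothing h (λ _ ()) reached)
        lemma (just (j , p)) h with i ≟ⁱ j
        ... | yes refl = answer v h
        ... | no i≢j   = verdict≡ v i (before (just (j , p)) h (λ { _ refl → i≢j refl }) reached)

    downs-all : ∀ s {X Y} → s ≤ t → Downcast 0 X → Rounds (downs s) X Y → Downcast s Y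
    downs-all zero    _   d []  = d
    downs-all (suc s) s<t d rs with split (downs s) rs
    ... | _ , rs′ , r ∷ [] = downward s<t (downs-all s (<⇒≤ s<t) d rs′) r

    resolved : ∀ {X Y} → Downcast t X → Round (resolve t) X Y → Matches C″ Y
    resolved {X} {Y} d round = record
      { self≡    = λ v → trans (cong self (becomes′ v)) (trans (self-after v (target (X v))) (self≡ v))
      ; cluster≡ = λ v → trans (cong cluster (becomes′ v)) (cluster-after v)
      ; root≡    = λ v → trans (cong root (becomes′ v)) (trans (root-after v (target (X v))) (root≡ v))
      ; tree≡    = λ v → trans (cong tree (becomes′ v)) (tree-after v)
      }
      where
      open Downcast d
      open Round round
      after : ∀ v → Maybe (Fin (degree v)) → Node (degree v)
      after v nothing  = record (X v) { cluster = refresh (X v) }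
      after v (just p) = record (X v)
        { cluster = if flag (inbox v p) then just (ident (inbox v p) , fromBits (number (inbox v p))) else nothing
        ; tree    = joinTree t (accepted p (inbox v p)) (tree (X v))
        }
      becomes′ : ∀ v → Y v ≡ after v (target (X v))
      becomes′ v = trans (becomes v) (lemma v)
        where
        lemma : ∀ v → recvN (resolve t) (X v) (inbox v) ≡ after v (target (X v))
        lemma v with target (X v)
        ... | nothing = refl
        ... | just _  = refl
      self-after : ∀ v g → self (after v g) ≡ self (X v)
      self-after v nothing  = refl
      self-after v (just _) = refl
      root-after : ∀ v g → root (after v g) ≡ root (X v)
      root-after v nothing  = refl
      root-after v (just _) = refl
      answer : ∀ v {p i} → home C (neighbour v p) ≡ just i → inbox v p ≡ ruling (X (neighbour v p)) i
        × verdict (X (neighbour v p)) i ≡ rules i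
      answer v {p} {i} h =
        trans (received v p) (cong (maybe (ruling (X (neighbour v p))) blank) (trans (clusterId≡ (neighbour v p)) h)) ,
        -- Members of a cluster belong to its tree, so after all slots each of them knows the
        -- verdict.
        verdict≡ (neighbour v p) i (member-reached (neighbour v p) (home∈ (neighbour v p) h))
      view : Maybe Id → Maybe (Id × ℕ)
      view = Maybe.map (λ i → i , level (state C″ i))
      joining : ∀ v {p i a} → home C (neighbour v p) ≡ just i → admits i ≡ a →
        (if flag (inbox v p) then just (ident (inbox v p) , fromBits (number (inbox v p))) else nothing) ≡ view (if a then just i else nothing)
        × accepted p (inbox v p) ≡ (if a then just (i , p) else nothing)
      joining v {p} {i} {a} h eq with answer v h
      ... | m , r with ruled {X} r
      ...   | fl , num = trans (cong (λ m → if flag m then just (ident m , fromBits (number m)) else nothing) m)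
                (trans (cong₂ (λ f k → if f then just (i , k) else nothing) (trans fl eq) num) (lemma a)) ,
              trans (cong (accepted p) m) (cong (λ f → if f then just (i , p) else nothing) (trans fl eq))
        where
        lemma : ∀ a → (if a then just (i , level (state C″ i)) else nothing) ≡ view (if a then just i else nothing)
        lemma true  = refl
        lemma false = refl
      cluster-after : ∀ v → cluster (after v (target (X v))) ≡ view (home C″ v)
      cluster-after v with fate ok t v
      ... | stays tg g _ = trans (cong (λ z → cluster (after v z)) (trans (target≡ v) tg))
              (trans (cong (Maybe.map _) (clusterId≡ v))
                (trans (lemma (home C v) refl) (sym (cong (λ z → view (maybe _ (home C v) z)) g))))
        where
        lemma : ∀ h → home C v ≡ h → Maybe.map (λ i → i , proj₂ (verdict (X v) i)) h ≡ view h
        lemma nothing  _  = refl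
        lemma (just i) eq = cong (λ z → just (i , proj₂ z)) (verdict≡ v i (member-reached v (home∈ v eq)))
      ... | joins tg hp g acc _ h = trans (cong (λ z → cluster (after v z)) (trans (target≡ v) tg))
              (trans (proj₁ (joining v hp acc)) (sym (cong view h)))
      ... | dies tg hp g acc _ h = trans (cong (λ z → cluster (after v z)) (trans (target≡ v) tg))
              (trans (proj₁ (joining v hp acc)) (sym (cong view h)))
      tree-after : ∀ v → tree (after v (target (X v))) ≡ trees C″ v
      tree-after v with fate ok t v
      ... | stays tg _ m = trans (cong (λ z → tree (after v z)) (trans (target≡ v) tg))
              (trans (tree≡ v) (sym (cong (λ z → joinTree t z (trees C v)) m)))
      ... | joins tg hp g acc m _ = trans (cong (λ z → tree (after v z)) (trans (target≡ v) tg))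
              (cong₂ (joinTree t) (trans (proj₂ (joining v hp acc)) (sym m)) (tree≡ v))
      ... | dies tg hp g acc m _ = trans (cong (λ z → tree (after v z)) (trans (target≡ v) tg))
              (cong₂ (joinTree t) (trans (proj₂ (joining v hp acc)) (sym m)) (tree≡ v))

  simulate : ∀ {t e C X Z} → (∀ r → level (state C r) ≤ b) → Forest t C → Matches C X → Rounds (stepInstrs t e) X Z →
    ∃[ tgt ] Valid C tgt × Matches (next t e C tgt) Z
  simulate {t} {e} {C} {X} level≤b forest matches (r₁ ∷ r₂ ∷ rs) with split (ups t) rs
  ... | X₁ , us , r₃ ∷ rs′ with split (downs t) rs′
  ...   | X₂ , ds , r₄ ∷ [] =
    tgt , ok , resolved t e level≤b ok forest (downs-all t e level≤b ok forest t ≤-refl (decided t e level≤b ok forest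
      (ups-asked t prepared us) (ups-flow t forest prepared counted us) r₃) ds) r₄
    where
    module A = Announce matches level≤b r₁
    module B = Propose A.matches′ r₂
    tgt = A.targets
    ok  = A.valid
    open Forest forest
    prepared : Asked C tgt t t _
    prepared = record
      { matches = B.matches′
      ; target≡ = B.target-same
      ; asked≡  = λ r t≤r r<t → contradiction (<-≤-trans r<t t≤r) (<-irrefl refl)
      }
    counted : Flow C (Step.demand C tgt) t _
    counted = record
      { total   = B.total
      ; bounded = λ i → ≤-trans (sum≤* {n} {k = 1} λ v → bit≤1 (Step.goal C tgt v is i)) (≤-reflexive (*-identityʳ n))
      ; support = λ v i ≢0 → member-reached t e level≤b ok forest v (home∈ v (B.support v i ≢0))
      }

  -- Iterating steps and phases

  record Checkpoint (i j t : ℕ) (C : Config) (X : Nodes) : Set where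
    field
      invariant : Invariant i j C
      forest    : Forest t C
      matches   : Matches C X

  runPhase : ∀ k {i j t C X Z} es → 0 < k → j + k ≡ K → Checkpoint i j t C X → Rounds (schedule t (phase k ++ es)) X Z →
    ∃[ C′ ] ∃[ Y ] Checkpoint (suc i) 0 (k + t) C′ Y × Rounds (schedule (k + t) es) Y Z
  runPhase (suc k) {t = t} es _ j+k≡K reached rs with split (stepInstrs t (isZero k)) rs
  ... | Y , now , later with simulate (Invariant.level≤b (Checkpoint.invariant reached)) (Checkpoint.forest reached) (Checkpoint.matches reached) now
  runPhase (suc zero) {i} {j} {t} {C} es _ j+k≡K reached rs | Y , now , later | tgt , ok , matches = next t true C tgt , Y , record
    { invariant = Bump.invariant (subst (λ k → Invariant i k (Step.advance C tgt t)) (trans (+-comm 1 j) j+k≡K)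
                    (Advance.invariant ok (Checkpoint.invariant reached) t))
    -- A bump changes only `state`, of which no field of `Forest` speaks; the fields are repacked
    -- for the new configuration.
    ; forest    = record { Forest (Growing.grown ok (Checkpoint.forest reached)) }
    ; matches   = matches
    } , later
  runPhase (suc (suc k)) {i} {j} {t} {Z = Z} es _ j+k≡K reached rs | Y , now , later | tgt , ok , matches
    with runPhase (suc k) es (s≤s z≤n) (trans (sym (+-suc j (suc k))) j+k≡K) record
      { invariant = Advance.invariant ok (Checkpoint.invariant reached) t
      ; forest    = Growing.grown ok (Checkpoint.forest reached)
      ; matches   = matches
      } later
  ... | C′ , Y′ , reached′ , rest = C′ , Y′ ,
    subst (λ t → Checkpoint (suc i) 0 t C′ Y′) (+-suc (suc k) t) reached′ ,
    subst (λ t → Rounds (schedule t es) Y′ Z) (+-suc (suc k) t) rest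

  runPhases : ∀ m {i t C X Z} → Checkpoint i 0 t C X → Rounds (schedule t (phases m)) X Z →
    ∃[ C′ ] ∃[ Y ] Checkpoint (m + i) 0 (m * K + t) C′ Y × Rounds (ups (m * K + t)) Y Z
  runPhases zero    reached rs = _ , _ , reached , rs
  runPhases (suc m) {i} {t} {Z = Z} reached rs with runPhase K (phases m) K>0 refl reached rs
  ... | C₁ , Y₁ , reached₁ , rs₁ with runPhases m reached₁ rs₁
  ...   | C₂ , Y₂ , reached₂ , rs₂ = C₂ , Y₂ ,
    subst₂ (λ i t → Checkpoint i 0 t C₂ Y₂) (+-suc m i) regroup reached₂ ,
    subst (λ t → Rounds (ups t) Y₂ Z) regroup rs₂
    where
    regroup : m * K + (K + t) ≡ suc m * K + t
    regroup = trans (sym (+-assoc (m * K) K t)) (cong (_+ t) (+-comm (m * K) K))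

  start : Config
  start = record
    { home  = λ v → if lookup S v then just (identifier v) else nothing
    ; state = λ _ → info 0 1 false
    ; trees = λ v → mkTree [ identifier v ] (λ _ → nothing)
    ; moves = λ _ → 0
    }

  started : Checkpoint 0 0 0 start (λ v → initNode (degree v) (localInputs identifier S v))
  started = record
    { invariant = record
      { founded   = founded
      ; separated = λ _ _ _ _ ()
      ; topmost   = λ _ _ _ ()
      ; level≤b   = λ _ → z≤n
      ; potential = λ _ _ → bit≤1 _
      ; moves≤    = λ _ → z≤n
      ; outside   = λ v out → cong (λ x → if x then just (identifier v) else nothing) out , refl
      ; budget    = budget
      ; growth    = λ _ _ → record
        { growing = λ _ → ≤-refl , ≤-reflexive (trans (+-identityʳ _) (trans (+-identityʳ K) (sym (*-identityˡ K))))
        ; halved  = λ ()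
        }
      }
    ; forest = record
      { own     = λ _ → here refl
      ; home∈   = home∈
      ; origin  = λ { _ (here refl) → inj₁ refl }
      ; log<    = λ _ ()
      ; log∈    = λ _ ()
      ; parent  = λ _ ()
      ; unique  = λ _ ()
      ; nonroot = λ _ ()
      ; size    = λ _ → ≤-refl
      }
    ; matches = record
      { self≡    = λ _ → refl
      ; cluster≡ = λ v → cluster≡ v (lookup S v)
      ; root≡    = λ _ → refl
      ; tree≡    = λ _ → refl
      }
    }
    where
    founded : ∀ v {r} → home start v ≡ just r → ∃[ u ] lookup S u ≡ true × identifier u ≡ r
    founded v eq with lookup S v in Sv
    founded v refl | true = v , Sv , refl
    home∈ : ∀ v {i} → home start v ≡ just i → i ∈ member (trees start v)
    home∈ v eq with lookup S v
    home∈ v refl | true = here refl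
    cluster≡ : ∀ v x → (if x then just (identifier v , 0) else nothing)
      ≡ Maybe.map (λ i → i , 0) (if x then just (identifier v) else nothing)
    cluster≡ v true  = refl
    cluster≡ v false = refl
    budget : wealth start + sum (lost start) ≤ ∣ S ∣ + sum (moves start)
    budget = ≤-reflexive (cong₂ _+_
      (trans (sum-cong-≗ λ v → *-identityʳ (living v)) (sym (∣S∣≡sum S)))
      (trans (sum-zero none) (sym (sum-zero {n} λ _ → refl))))
      where
      none : ∀ v → lost start v ≡ 0
      none v with lookup S v
      ... | true  = refl
      ... | false = refl

  record Finished (m : ℕ) (C : Config) (Z : Nodes) : Set where
    field
      invariant : Invariant m 0 C
      forest    : Forest (m * K) C
      matches   : Matches C Z
      -- This is the gain of the closing `ups`: it includes the edges of the last step.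
      asked≡    : ∀ r → r < m * K → ∀ v p → asked (Z v) r p ≡ upward (trees C (neighbour v p)) r (back v p)

  finish : ∀ m {Z} → Rounds (schedule 0 (phases m)) (λ v → initNode (degree v) (localInputs identifier S v)) Z →
    ∃[ C ] Finished m C Z
  finish m {Z} rs with runPhases m started rs
  ... | C , Y , reached , rs′ = C , record
    { invariant = subst (λ i → Invariant i 0 C) (+-identityʳ m) (Checkpoint.invariant reached)
    ; forest    = subst (λ t → Forest t C) (+-identityʳ (m * K)) (Checkpoint.forest reached)
    ; matches   = Asked.matches asked₀
    ; asked≡    = λ r r< v p → Asked.asked≡ asked₀ r z≤n (subst (r <_) (sym (+-identityʳ (m * K))) r<) v p
    }
    where
    asked₀ : Asked C (λ v → target (Y v)) (m * K + 0) 0 Z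
    asked₀ = ups-asked (m * K + 0) record
      { matches = Checkpoint.matches reached
      ; target≡ = λ _ → refl
      ; asked≡  = λ r t≤r r<t → contradiction (<-≤-trans r<t t≤r) (<-irrefl refl)
      } rs′

  -- The output

  module _ (m : ℕ) {C : Config} {Z : Nodes} (finished : Finished m C Z)
           (M-large : 3 * m + 2 ≤ M) (m-large : 2 * (2 ^ b * M * 4 ^ b) < 2 ^ m) where
    open Finished finished
    open Invariant invariant
    open Forest forest
    open Matches matches

    T : ℕ
    T = m * K

    out : ∀ v → LocalOutput (degree v)
    out v = outputNode T (Z v)

    open Clustering P out renaming (tree to treeOf)

    -- A vertex of `S` accounts for its initial token and at most `3 * m + 1` moves, others for
    -- nothing.
    allowance : ∣ S ∣ + sum (moves C) ≤ ∣ S ∣ * M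
    allowance = begin
      ∣ S ∣ + sum (moves C)                      ≡⟨ cong (_+ sum (moves C)) (∣S∣≡sum S) ⟩
      sum living + sum (moves C)                 ≡⟨ sym (∑-distrib-+ living (moves C)) ⟩
      sum (λ v → living v + moves C v)           ≤⟨ sum-mono spent ⟩
      sum (λ v → living v * M)                   ≡⟨ sym (*-distribʳ-sum M living) ⟩
      sum living * M                             ≡⟨ cong (_* M) (sym (∣S∣≡sum S)) ⟩
      ∣ S ∣ * M                                  ∎
      where
      open ≤-Reasoning
      spent : ∀ v → living v + moves C v ≤ living v * M
      spent v with lookup S v in Sv
      ... | false = ≤-reflexive (proj₂ (outside v Sv))
      ... | true  = begin
        1 + moves C v        ≤⟨ +-monoʳ-≤ 1 (moves≤ v) ⟩
        1 + (3 * m + 1)      ≡⟨ sym (+-suc (3 * m) 1) ⟩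
        3 * m + 2            ≤⟨ M-large ⟩
        M                    ≡⟨ sym (*-identityˡ M) ⟩
        1 * M                ∎

    ∣S∣≤2^b : ∣ S ∣ ≤ 2 ^ b
    ∣S∣≤2^b = ≤-trans (≤-reflexive (∣S∣≡sum S)) (≤-trans (sum≤* {n} {k = 1} λ v → bit≤1 (lookup S v))
      (≤-trans (≤-reflexive (*-identityʳ n)) (injective⇒≤2^ identifier-injective)))

    -- A cluster that never finished would own more tokens than were ever issued.
    level≡b : ∀ u → lookup S u ≡ true → level (state C (identifier u)) ≡ b
    level≡b u Su with m≤n⇒m<n∨m≡n (level≤b (identifier u))
    ... | inj₂ eq = eq
    ... | inj₁ lt = contradiction (<-≤-trans m-large rich) (≤⇒≯ poor)
      where
      open ≤-Reasoning
      I = state C (identifier u)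
      funds : tokens I ≤ 2 ^ b * M
      funds = begin
        tokens I                                           ≡⟨ sym (*-identityˡ (tokens I)) ⟩
        1 * tokens I                                       ≡⟨ cong (λ x → bit x * tokens I) (sym Su) ⟩
        living u * tokens I                                ≤⟨ term≤sum (λ r → living r * tokens (state C (identifier r))) u ⟩
        wealth C                                           ≤⟨ m≤m+n _ _ ⟩
        wealth C + sum (lost C)                            ≤⟨ budget ⟩
        ∣ S ∣ + sum (moves C)                              ≤⟨ allowance ⟩
        ∣ S ∣ * M                                          ≤⟨ *-monoˡ-≤ M ∣S∣≤2^b ⟩
        2 ^ b * M                                          ∎
      poor : 2 * (tokens I * 4 ^ level I) ≤ 2 * (2 ^ b * M * 4 ^ b)
      poor = *-monoʳ-≤ 2 (*-mono-≤ funds (^-monoʳ-≤ 4 (level≤b (identifier u))))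
      rich : 2 ^ m ≤ 2 * (tokens I * 4 ^ level I)
      rich with stalled I in st
      ... | true  = Growth.halved (growth (identifier u) lt) st
      ... | false = ≤-trans (proj₁ (Growth.growing (growth (identifier u) lt) st)) (m≤m+n _ _)

    cluster-out : ∀ v → LocalOutput.cluster (out v) ≡ Maybe.map fromBits (home C v)
    cluster-out v = cong (Maybe.map fromBits) (clusterId≡ v)

    home-of : ∀ {ℓ v} → Cluster ℓ v → ∃[ i ] home C v ≡ just i × ℓ ≡ fromBits i
    home-of {ℓ} {v} c with home C v | trans (sym (cluster-out v)) c
    ... | just i | eq = i , refl , sym (just-injective eq)

    S′-home : ∀ v → lookup S′ v ≡ is-just (home C v)
    S′-home v = trans (lookup∘tabulate (λ v → is-just (LocalOutput.cluster (out v))) v)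
      (trans (cong is-just (cluster-out v)) (lemma (home C v)))
      where
      lemma : ∀ h → is-just (Maybe.map fromBits h) ≡ is-just h
      lemma nothing  = refl
      lemma (just _) = refl

    half′ : ∣ S ∣ ≤ 2 * ∣ S′ ∣
    -- Each vertex of `S` is worth `2 * M`, either as lost or as surviving. The losses are at most
    -- `∣ S ∣ * M`, half of the total, so adding this term to both sides and cancelling it leaves
    -- the claim times `M`.
    half′ = *-cancelʳ-≤ _ _ M {{>-nonZero M>0}} (+-cancelˡ-≤ (∣ S ∣ * M) _ _ (begin
      ∣ S ∣ * M + ∣ S ∣ * M                     ≡⟨ double ∣ S ∣ M ⟩
      ∣ S ∣ * (2 * M)                           ≡⟨ cong (_* (2 * M)) (∣S∣≡sum S) ⟩
      sum living * (2 * M)                      ≡⟨ *-distribʳ-sum (2 * M) living ⟩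
      sum (λ v → living v * (2 * M))            ≡⟨ sum-cong-≗ accounted ⟩
      sum (λ v → lost C v + bit (lookup S′ v) * (2 * M)) ≡⟨ ∑-distrib-+ (lost C) (λ v → bit (lookup S′ v) * (2 * M)) ⟩
      sum (lost C) + sum (λ v → bit (lookup S′ v) * (2 * M))
        ≡⟨ cong (sum (lost C) +_) (sym (*-distribʳ-sum (2 * M) (λ v → bit (lookup S′ v)))) ⟩
      sum (lost C) + sum (λ v → bit (lookup S′ v)) * (2 * M) ≡⟨ cong (λ z → sum (lost C) + z * (2 * M)) (sym (∣S∣≡sum S′)) ⟩
      sum (lost C) + ∣ S′ ∣ * (2 * M)           ≤⟨ +-monoˡ-≤ _ (≤-trans (m≤n+m _ (wealth C)) (≤-trans budget allowance)) ⟩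
      ∣ S ∣ * M + ∣ S′ ∣ * (2 * M)              ≡⟨ cong (∣ S ∣ * M +_) (regroup ∣ S′ ∣ M) ⟩
      ∣ S ∣ * M + 2 * ∣ S′ ∣ * M                ∎))
      where
      open ≤-Reasoning
      M>0 : 0 < M
      M>0 = ≤-trans (s≤s z≤n) (≤-trans (m≤n+m 2 (3 * m)) M-large)
      double : ∀ s k → s * k + s * k ≡ s * (2 * k)
      double = solve-∀
      regroup : ∀ s k → s * (2 * k) ≡ 2 * s * k
      regroup = solve-∀
      accounted : ∀ v → living v * (2 * M) ≡ lost C v + bit (lookup S′ v) * (2 * M)
      accounted v rewrite S′-home v with lookup S v in Sv
      ... | false rewrite proj₁ (outside v Sv) = refl
      ... | true with home C v
      ...   | nothing = trans (+-identityʳ _) (sym (trans (+-identityʳ _) (+-identityʳ _)))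
      ...   | just _  = refl

    S′-living : ∀ {v} → v ∈ₛ S′ → v ∈ₛ S
    S′-living {v} v∈ with lookup S v in Sv
    ... | true  = lookup⇒[]= v S Sv
    ... | false = contradiction (trans (sym ([]=⇒lookup v∈)) (trans (S′-home v) (cong is-just (proj₁ (outside v Sv))))) λ ()

    home-level : ∀ v {r} → home C v ≡ just r → level (state C r) ≡ b
    home-level v h with founded v h
    ... | u , Su , refl = level≡b u Su

    separated′ : ∀ {u v ℓ ℓ′} → Cluster ℓ u → Cluster ℓ′ v → Adj u v → ℓ ≡ ℓ′
    separated′ {u} {v} cu cv e with home-of {v = u} cu | home-of {v = v} cv
    ... | r , hu , refl | q , hv , refl = cong fromBits (bitAt-extensional r q λ k k<b →
      separated e hu hv k (subst (k <_) (sym (home-level u hu)) k<b) (subst (k <_) (sym (home-level v hv)) k<b))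

    -- The Steiner tree of one cluster

    module SteinerTree (i : Id) (root : Fin n) (root-id : identifier root ≡ i) where
      ℓ : ℕ
      ℓ = fromBits i

      H = treeOf ℓ
      open VertexEdgeSet H

      Parent : Fin n → Fin n → Set
      Parent u w = ∃[ s ] ∃[ p ] log (trees C u) s ≡ just (i , p) × neighbour u p ≡ w

      vertex⇒ : ∀ {v} → V v → i ∈ member (trees C v)
      vertex⇒ {v} (_ , E∈) with ∈-map⁻ _ E∈
      ... | j , j∈ , eq with fromBits-injective {x = i} {j} (cong proj₁ eq)
      ...   | refl = subst (λ R → i ∈ member R) (tree≡ v) j∈

      vertex⇐ : ∀ {v} → i ∈ member (trees C v) → V v
      vertex⇐ {v} i∈ = edges T (Z v) i ,
        ∈-map⁺ (λ i → fromBits i , edges T (Z v) i) (subst (λ R → i ∈ member R) (sym (tree≡ v)) i∈)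

      edge-port : ∀ {v p} → p ∈ₛ edges T (Z v) i → ∃[ s ] s < T × IsEdge (Z v) i p s
      edge-port {v} {p} p∈ = witness (anyUpTo? (edge? (Z v) i p) T)
          (trans (sym (lookup∘tabulate (λ p → does (anyUpTo? (edge? (Z v) i p) T)) p)) ([]=⇒lookup p∈))
        where
        witness : ∀ {A : Set} (d : Dec A) → does d ≡ true → A
        witness (yes a) _ = a

      port-edge : ∀ {v p s} → s < T → IsEdge (Z v) i p s → p ∈ₛ edges T (Z v) i
      port-edge {v} {p} {s} s<T e = lookup⇒[]= p _
        (trans (lookup∘tabulate (λ p → does (anyUpTo? (edge? (Z v) i p) T)) p)
          (dec-true (anyUpTo? (edge? (Z v) i p) T) (s , s<T , e)))

      orient : ∀ {u w} → E u w → Parent u w ⊎ Parent w u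
      orient {u} (_ , E∈ , p , p∈ , refl) with ∈-map⁻ _ E∈
      ... | j , j∈ , eq with fromBits-injective {x = i} {j} (cong proj₁ eq)
      ...   | refl with edge-port {u} (subst (p ∈ₛ_) (cong proj₂ eq) p∈)
      ...     | s , s<T , inj₁ e = inj₁ (s , p , upward-log (trees C u) s (subst (λ R → upward R s p ≡ just i) (tree≡ u) e) , refl)
      ...     | s , s<T , inj₂ e = inj₂ (s , back u p ,
                upward-log (trees C (neighbour u p)) s (trans (sym (asked≡ s s<T u p)) e) , neighbour-back u p)

      parent-edge : ∀ {u w} → Parent u w → E u w
      parent-edge {u} (s , p , h , refl) = edges T (Z u) i , proj₂ (vertex⇐ (log∈ u h)) , p ,
        port-edge {u} (log< u h) (inj₁ (subst (λ R → upward R s p ≡ just i) (sym (tree≡ u)) (upward-just (trees C u) s h))) , refl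

      parent-vertex : ∀ {u w} → Parent u w → i ∈ member (trees C w)
      parent-vertex {u} (s , p , h , refl) with parent u h
      ... | inj₁ refl             = own (neighbour u p)
      ... | inj₂ (r , q , _ , h′) = log∈ (neighbour u p) h′

      child-edge : ∀ {u w} → Parent u w → E w u
      child-edge {u} (s , p , h , refl) = edges T (Z w) i , proj₂ (vertex⇐ (parent-vertex {u} (s , p , h , refl))) , back u p ,
        port-edge {w} (log< u h) (inj₂ (trans (asked≡ s (log< u h) w (back u p))
          (trans (upward-back (trees C) s p (back u p) refl (neighbour-back u p)) (upward-just (trees C u) s h)))) ,
        neighbour-back u p
        where w = neighbour u p

      edge-symmetric : ∀ {u w} → E u w → E w u
      edge-symmetric e with orient e
      ... | inj₁ above = child-edge above
      ... | inj₂ below = parent-edge below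

      edge-endpoint : ∀ {u w} → E u w → V u
      edge-endpoint (es , es∈ , _) = es , es∈

      edge⊆G : ∀ {u w} → E u w → Adj u w
      edge⊆G {u} (_ , _ , p , _ , refl) = neighbour-adjacent u p

      Joined : Fin n → ℕ → Set
      Joined v s = joined (trees C v) s ≡ just i

      joined? : ∀ v s → Dec (Joined v s)
      joined? v s = ≡-decᵐ _≟ⁱ_ (joined (trees C v) s) (just i)

      joined-log : ∀ v {s} → Joined v s → ∃[ p ] log (trees C v) s ≡ just (i , p)
      joined-log v {s} eq with log (trees C v) s
      joined-log v refl | just (_ , p) = p , refl

      -- The joining step shifted by one, which leaves 0 for the root; `unique` makes it independent
      -- of the step that the search finds.
      height : Fin n → ℕ
      height v with anyUpTo? (joined? v) T
      ... | yes (s , _) = suc s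
      ... | no _        = 0

      height-log : ∀ v {s p} → log (trees C v) s ≡ just (i , p) → height v ≡ suc s
      height-log v {s} h with anyUpTo? (joined? v) T
      ... | yes (s′ , _ , j) = cong suc (unique v (proj₂ (joined-log v j)) h)
      ... | no ∄             = contradiction (s , log< v h , cong (Maybe.map proj₁) h) ∄

      height-root : ∀ v → identifier v ≡ i → height v ≡ 0
      height-root v eq with anyUpTo? (joined? v) T
      ... | yes (s′ , _ , j) = contradiction eq (nonroot v (proj₂ (joined-log v j)))
      ... | no _             = refl

      parent-lower : ∀ {u w} → Parent u w → height w < height u
      parent-lower {u} (s , p , h , refl) with parent u h
      ... | inj₁ eq = subst₂ _<_ (sym (height-root (neighbour u p) eq)) (sym (height-log u h)) (s≤s z≤n)
      ... | inj₂ (r , q , r<s , h′) =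
        subst₂ _<_ (sym (height-log (neighbour u p) h′)) (sym (height-log u h)) (s≤s r<s)

      parent-unique : ∀ {u w w′} → Parent u w → Parent u w′ → w ≡ w′
      parent-unique {u} (s , p , h , refl) (s′ , p′ , h′ , refl) with unique u h h′
      ... | refl = cong (λ z → neighbour u (proj₂ z)) (just-injective (trans (sym h) h′))

      -- Joining steps decrease strictly along parents, so the number of steps bounds the depth.
      -- `bound` makes the strong induction on `s` structural.
      climb : ∀ bound {v s p} → s < bound → log (trees C v) s ≡ just (i , p) → ∃[ k ] k ≤ suc s × Walk E k v root
      climb (suc bound) {v} {s} {p} (s≤s s≤bound) h with parent v h
      ... | inj₁ eq = 1 , s≤s z≤n , step (parent-edge (s , p , h , refl))
              (subst (Walk E 0 (neighbour v p)) (identifier-injective (trans eq (sym root-id))) here)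
      ... | inj₂ (r , q , r<s , h′) with climb bound (<-≤-trans r<s s≤bound) h′
      ...   | k , k≤ , w = suc k , s≤s (≤-trans k≤ r<s) , step (parent-edge (s , p , h , refl)) w

      to-root : ∀ {v} → V v → ∃[ k ] k ≤ T × Walk E k v root
      to-root {v} Vv with origin v (vertex⇒ Vv)
      ... | inj₁ eq = 0 , z≤n , subst (Walk E 0 v) (identifier-injective (trans eq (sym root-id))) here
      ... | inj₂ (s , p , h) with climb (suc s) ≤-refl h
      ...   | k , k≤ , w = k , ≤-trans k≤ (log< v h) , w

      root∈ : V root
      root∈ = vertex⇐ (subst (_∈ member (trees C root)) root-id (own root))

      isSubtree : IsSubtree G H
      isSubtree = record
        { edges⊆G   = edge⊆G
        ; symmetric = edge-symmetric
        ; endpoint  = edge-endpoint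
        ; nonempty  = root , root∈
        ; connected = λ Vu Vv → let _ , _ , w = to-root Vu ; _ , _ , w′ = to-root Vv in
                        _ , w ++ʷ reverseʷ edge-symmetric w′
        ; acyclic   = forest-acyclic height orient parent-unique parent-lower
        }

      radius≤ : Radius≤ H T
      radius≤ = root , root∈ , λ Vv → let k , k≤ , w = to-root Vv in k , k≤ , reverseʷ edge-symmetric w

      terminal : ∀ {v} → Cluster ℓ v → V v
      terminal {v} c with home-of {v = v} c
      ... | j , h , eq with fromBits-injective {x = i} {j} eq
      ...   | refl = vertex⇐ (home∈ v h)

      diameter≤ : WeakDiameter≤ G (Cluster ℓ) (2 * T)
      diameter≤ cu cv with to-root (terminal cu) | to-root (terminal cv)
      ... | k , k≤ , w | k′ , k′≤ , w′ = k + k′ , +-mono-≤ k≤ (≤-trans k′≤ (m≤m+n T 0)) ,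
        mapʷ edge⊆G (w ++ʷ reverseʷ edge-symmetric w′)

    founder : ∀ {ℓ} → IsLabel ℓ → ∃[ i ] ∃[ u ] identifier u ≡ i × ℓ ≡ fromBits i
    founder (v , c) with home-of {v = v} c
    ... | i , h , eq with founded v h
    ...   | u , _ , id≡ = i , u , id≡ , eq

    isClustering : ∀ {diam rad load} → 2 * T ≤ diam → T ≤ rad → 3 * m + 2 ≤ load → IsClustering P S out diam rad load
    isClustering {diam} {rad} {load} T≤diam T≤rad m≤load = record
      { S′⊆S         = S′-living
      ; half         = half′
      ; separated    = λ {u} {v} → separated′ {u} {v}
      ; weakDiameter = diameter
      ; steinerTree  = steiner
      ; radius       = radius
      ; congestion   = congestion
      }
      where
      diameter : ∀ {ℓ} → IsLabel ℓ → WeakDiameter≤ G (Cluster ℓ) diam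
      diameter label cu cv with founder label
      ... | i , u , id≡ , refl with SteinerTree.diameter≤ i u id≡ cu cv
      ...   | k , k≤ , w = k , ≤-trans k≤ T≤diam , w
      steiner : ∀ {ℓ} → IsLabel ℓ → IsSteinerTree G (Cluster ℓ) (treeOf ℓ)
      steiner label with founder label
      ... | i , u , id≡ , refl = record
        { isSubtree = SteinerTree.isSubtree i u id≡ ; terminals = SteinerTree.terminal i u id≡ }
      radius : ∀ {ℓ} → IsLabel ℓ → Radius≤ (treeOf ℓ) rad
      radius label with founder label
      ... | i , u , id≡ , refl with SteinerTree.radius≤ i u id≡
      ...   | c , c∈ , near = c , c∈ , λ Vv → let k , k≤ , w = near Vv in k , ≤-trans k≤ T≤rad , w
      congestion : ∀ v → AtMost load (λ ℓ → IsLabel ℓ × VertexEdgeSet.V (treeOf ℓ) v)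
      congestion v xs uniq all = begin
        -- A node is in the tree that it founded and in at most one more per move.
        length xs                                        ≤⟨ unique-length uniq (All.map listed all) ⟩
        length (List.map fromBits (member (trees C v)))  ≡⟨ length-map fromBits (member (trees C v)) ⟩
        length (member (trees C v))                      ≤⟨ size v ⟩
        suc (moves C v)                                  ≤⟨ s≤s (moves≤ v) ⟩
        suc (3 * m + 1)                                  ≡⟨ sym (+-suc (3 * m) 1) ⟩
        3 * m + 2                                        ≤⟨ m≤load ⟩
        load                                             ∎
        where
        open ≤-Reasoning
        listed : ∀ {ℓ} → IsLabel ℓ × VertexEdgeSet.V (treeOf ℓ) v → ℓ ∈ List.map fromBits (member (trees C v))
        listed (label , Vv) with founder label
        ... | i , u , id≡ , refl = ∈-map⁺ fromBits (SteinerTree.vertex⇒ i u id≡ Vv)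

-- Parameters and round count

-- The factor 8 comes from `256 = 2 ^ 8` in `m-large`; then `26 = 3 * 8 + 2` from `3 * m + 2 ≤ M`,
-- and `104 = 4 * 26` from `4 * M ≤ K`.
phaseCount moveBudget phaseLength : ℕ → ℕ
phaseCount  b = 8 * suc b
moveBudget  b = 26 * suc b
phaseLength b = 104 * suc b

^-distribʳ-* : ∀ k m n → (m * n) ^ k ≡ m ^ k * n ^ k
^-distribʳ-* zero    m n = refl
^-distribʳ-* (suc k) m n = trans (cong (m * n *_) (^-distribʳ-* k m n)) (regroup m n (m ^ k) (n ^ k))
  where
  regroup : ∀ m n x y → m * n * (x * y) ≡ m * x * (n * y)
  regroup = solve-∀

module _ (b : ℕ) where
  private
    m = phaseCount b
    M = moveBudget b
    K = phaseLength b

  open Protocol b K M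

  length-ups : ∀ t → length (ups t) ≡ t
  length-ups zero    = refl
  length-ups (suc t) = cong suc (length-ups t)

  length-downs : ∀ t → length (downs t) ≡ t
  length-downs zero    = refl
  length-downs (suc t) = trans (length-++ (downs t)) (trans (+-comm _ 1) (cong suc (length-downs t)))

  length-step : ∀ t e → length (stepInstrs t e) ≡ 4 + 2 * t
  length-step t e = trans (cong (2 +_) (trans (length-++ (ups t)) (cong₂ (λ x y → x + suc y) (length-ups t)
    (trans (length-++ (downs t)) (cong (_+ 1) (length-downs t)))))) (regroup t)
    where
    regroup : ∀ t → 2 + (t + suc (t + 1)) ≡ 4 + 2 * t
    regroup = solve-∀

  -- Every step is charged at the price of the last; the final `N` pays for the closing `ups`.
  length-schedule : ∀ N t es → t + length es ≤ N → length (schedule t es) ≤ length es * (4 + 2 * N) + N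
  length-schedule N t []       le = subst (_≤ N) (trans (+-identityʳ t) (sym (length-ups t))) le
  length-schedule N t (e ∷ es) le = begin
    length (stepInstrs t e ++ schedule (suc t) es)              ≡⟨ length-++ (stepInstrs t e) ⟩
    length (stepInstrs t e) + length (schedule (suc t) es)
      ≤⟨ +-mono-≤ (≤-trans (≤-reflexive (length-step t e)) (+-monoʳ-≤ 4 (*-monoʳ-≤ 2 (≤-trans (m≤m+n t _) le))))
                  (length-schedule N (suc t) es (subst (_≤ N) (+-suc t (length es)) le)) ⟩
    4 + 2 * N + (length es * (4 + 2 * N) + N)                   ≡⟨ sym (+-assoc (4 + 2 * N) _ N) ⟩
    suc (length es) * (4 + 2 * N) + N                           ∎
    where open ≤-Reasoning

  steps : List Bool
  steps = phases m

  rounds≤ : length (schedule 0 steps) ≤ 7 * ((m * K) * (m * K))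
  rounds≤ = begin
    length (schedule 0 steps)                  ≤⟨ length-schedule N 0 steps ≤-refl ⟩
    N * (4 + 2 * N) + N                        ≤⟨ ≤-reflexive (cong (λ N → N * (4 + 2 * N) + N) N≡) ⟩
    L * (4 + 2 * L) + L                        ≡⟨ regroup L ⟩
    5 * (L * 1) + 2 * (L * L)                  ≤⟨ +-monoˡ-≤ _ (*-monoʳ-≤ 5 (*-monoʳ-≤ L L>0)) ⟩
    5 * (L * L) + 2 * (L * L)                  ≡⟨ sym (*-distribʳ-+ (L * L) 5 2) ⟩
    7 * (L * L)                                ∎
    where
    open ≤-Reasoning
    N = length steps
    L = m * K
    N≡ : N ≡ L
    N≡ = length-phases m
    L>0 : 1 ≤ L
    L>0 = *-mono-≤ {1} {m} {1} {K} (s≤s z≤n) (s≤s z≤n)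
    regroup : ∀ n → n * (4 + 2 * n) + n ≡ 5 * (n * 1) + 2 * (n * n)
    regroup = solve-∀

  4M≤K : 4 * M ≤ K
  4M≤K = ≤-reflexive (sym (*-assoc 4 26 (suc b)))

  3m+2≤M : 3 * m + 2 ≤ M
  3m+2≤M = begin
    3 * (8 * suc b) + 2          ≤⟨ +-monoʳ-≤ (3 * (8 * suc b)) (*-monoʳ-≤ 2 (s≤s (z≤n {b}))) ⟩
    3 * (8 * suc b) + 2 * suc b  ≡⟨ regroup (suc b) ⟩
    26 * suc b                   ∎
    where
    open ≤-Reasoning
    regroup : ∀ x → 3 * (8 * x) + 2 * x ≡ 26 * x
    regroup = solve-∀

  m-large : 2 * (2 ^ b * M * 4 ^ b) < 2 ^ m
  m-large = begin-strict
    2 * (2 ^ b * (26 * suc b) * 4 ^ b)      ≡⟨ regroup (2 ^ b) (suc b) (4 ^ b) ⟩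
    52 * (suc b * (2 ^ b * 4 ^ b))          ≡⟨ cong (λ z → 52 * (suc b * z)) (sym (^-distribʳ-* b 2 4)) ⟩
    -- The generous `suc b ≤ 32 ^ b` is chosen because `32 * 8` is a power of 2.
    52 * (suc b * 8 ^ b)                    ≤⟨ *-monoʳ-≤ 52 (*-monoˡ-≤ (8 ^ b) (≤-trans (b<2^b b) (^-monoˡ-≤ b (s≤s (s≤s z≤n))))) ⟩
    52 * (32 ^ b * 8 ^ b)                   ≡⟨ cong (52 *_) (sym (^-distribʳ-* b 32 8)) ⟩
    52 * 256 ^ b                            <⟨ *-monoˡ-< (256 ^ b) {{m^n≢0 256 b}} {52} {256} (m<m+n 52 {204} (s≤s z≤n)) ⟩
    256 * 256 ^ b                           ≡⟨ ^-*-assoc 2 8 (suc b) ⟩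
    2 ^ (8 * suc b)                         ∎
    where
    open ≤-Reasoning
    regroup : ∀ p x q → 2 * (p * (26 * x) * q) ≡ 52 * (x * (p * q))
    regroup = solve-∀

  clustering : ∀ {w n : ℕ} (fits : suc (b + suc b) ≤ w) {G : Graph n} (P : PortNumbering G)
    (identifier : Fin n → Vec Bool b) → Injective _≡_ _≡_ identifier → (S : Subset n) →
    ∀ {diam rad load} → 2 * (m * K) ≤ diam → m * K ≤ rad → 3 * m + 2 ≤ load →
    IsClustering P S (Execution.result (Compiled.algorithm fits steps) P (localInputs identifier S)) diam rad load
  clustering fits P identifier injective S {diam} {rad} {load} d r l =
    subst (λ T → IsClustering P S (λ v → outputNode T (final v)) diam rad load) (sym (length-phases m))
      (C.isClustering m (proj₂ (C.finish m rounds)) 3m+2≤M m-large d r l)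
    where
    open Global P
    open Run fits steps (localInputs identifier S)
    module C = Carving b K M P identifier injective S 4M≤K (s≤s z≤n)

-- Only needed for b > c * lg n, where packets may exceed the bandwidth.
idleAlgorithm : ∀ {w b} → Algorithm w (LocalInput b) LocalOutput
idleAlgorithm = record
  { State   = λ _ → ⊤
  ; init    = λ _ _ → tt
  ; send    = λ _ _ → record { vec = [] ; bound = z≤n }
  ; receive = λ _ _ → tt
  ; rounds  = 0
  ; output  = λ _ → record { cluster = nothing ; trees = [] }
  }

module _ (c n b : ℕ) (b≤ : b ≤ c * lg n) where

  -- As `lg n` is positive, one more multiple of it absorbs the 1.
  1+b≤ : suc b ≤ suc c * lg n
  1+b≤ = +-mono-≤ (s≤s z≤n) b≤

  fits : suc (b + suc b) ≤ 2 * suc c * lg n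
  fits = begin
    suc b + suc b              ≡⟨ cong (suc b +_) (sym (+-identityʳ (suc b))) ⟩
    2 * suc b                  ≤⟨ *-monoʳ-≤ 2 1+b≤ ⟩
    2 * (suc c * lg n)         ≡⟨ sym (*-assoc 2 (suc c) (lg n)) ⟩
    2 * suc c * lg n           ∎
    where open ≤-Reasoning

-- The decision is an argument, so that `correct` can match on it and let the algorithm reduce.
compiled : ∀ c n b → Dec (b ≤ c * lg n) → Algorithm (2 * suc c * lg n) (LocalInput b) LocalOutput
compiled c n b (yes b≤) = Protocol.Compiled.algorithm b (phaseLength b) (moveBudget b) (fits c n b b≤) (steps b)
compiled c n b (no _)   = idleAlgorithm

stepFactor : ℕ → ℕ
stepFactor c = 832 * (suc c * suc c)

stepCount≤ : ∀ c n b → b ≤ c * lg n → phaseCount b * phaseLength b ≤ stepFactor c * lg n ^ 2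
stepCount≤ c n b b≤ = begin
  8 * suc b * (104 * suc b)                  ≤⟨ *-mono-≤ (*-monoʳ-≤ 8 (1+b≤ c n b b≤)) (*-monoʳ-≤ 104 (1+b≤ c n b b≤)) ⟩
  8 * (suc c * lg n) * (104 * (suc c * lg n)) ≡⟨ regroup (suc c) (lg n) ⟩
  832 * (suc c * suc c) * lg n ^ 2           ∎
  where
  open ≤-Reasoning
  regroup : ∀ a l → 8 * (a * l) * (104 * (a * l)) ≡ 832 * (a * a) * (l * (l * 1))
  regroup = solve-∀

theorem2p2 : ∀ (c : ℕ) →
    ∃[ β ] ∃[ κ-rounds ] ∃[ κ-diam ] ∃[ κ-rad ] ∃[ κ-load ]
    Σ[ 𝒜 ∈ CONGESTAlgorithm β ]
    (∀ (n b : ℕ) → b ≤ c * lg n →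
    Algorithm.rounds (𝒜 n b) ≤ κ-rounds * lg n ^ 4
    × (∀ (G : Graph n) (P : PortNumbering G)
    (identifier : Fin n → Vec Bool b) → Injective _≡_ _≡_ identifier →
    (S : Subset n) →
    IsClustering P S
    (Execution.result (𝒜 n b) P (localInputs identifier S))
    (κ-diam * lg n ^ 2) (κ-rad * lg n ^ 2) (κ-load * lg n)))
-- With `T ≤ D * lg n ^ 2` steps in all, the rounds number at most `7 * (T * T)`, the radius is at
-- most `T` and the weak-diameter at most `2 * T`; the load is bounded through `M = 26 * suc b`.
theorem2p2 c = 2 * suc c , 7 * (D * D) , 2 * D , D , 26 * suc c , (λ n b → compiled c n b (b ≤? c * lg n)) ,
  λ n b b≤ → correct n b b≤ (b ≤? c * lg n)
  where
  open ≤-Reasoning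
  D = stepFactor c
  correct : ∀ n b → b ≤ c * lg n → (b≤? : Dec (b ≤ c * lg n)) →
    Algorithm.rounds (compiled c n b b≤?) ≤ 7 * (D * D) * lg n ^ 4
    × (∀ (G : Graph n) (P : PortNumbering G) (identifier : Fin n → Vec Bool b) → Injective _≡_ _≡_ identifier → (S : Subset n) →
       IsClustering P S (Execution.result (compiled c n b b≤?) P (localInputs identifier S))
         (2 * D * lg n ^ 2) (D * lg n ^ 2) (26 * suc c * lg n))
  correct n b _  (yes b≤) =
    (begin
      length (Protocol.schedule b (phaseLength b) (moveBudget b) 0 (steps b))  ≤⟨ rounds≤ b ⟩
      7 * (T * T)                                 ≤⟨ *-monoʳ-≤ 7 (*-mono-≤ T≤ T≤) ⟩
      7 * (D * lg n ^ 2 * (D * lg n ^ 2))         ≡⟨ regroup D (lg n) ⟩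
      7 * (D * D) * lg n ^ 4                      ∎) ,
    λ G P identifier injective S → clustering b (fits c n b b≤) P identifier injective S
      (≤-trans (*-monoʳ-≤ 2 T≤) (≤-reflexive (sym (*-assoc 2 D (lg n ^ 2)))))
      T≤
      (≤-trans (3m+2≤M b) (≤-trans (*-monoʳ-≤ 26 (1+b≤ c n b b≤)) (≤-reflexive (sym (*-assoc 26 (suc c) (lg n))))))
    where
    T = phaseCount b * phaseLength b
    T≤ : T ≤ D * lg n ^ 2
    T≤ = stepCount≤ c n b b≤
    regroup : ∀ d l → 7 * (d * (l * (l * 1)) * (d * (l * (l * 1)))) ≡ 7 * (d * d) * (l * (l * (l * (l * 1))))
    regroup = solve-∀
  correct n b b≤ (no b≰) = contradiction b≤ b≰
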